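{- Let $\mathbb F_q$ be a finite field of characteristic at least five, and let $\sigma\in\mathbb F_q$ be a nonsquare. Then any cubic rational expression $R(x)$ over $\mathbb F_q$ with at most three ramification points in $\mathbb P^1(\overline{\mathbb F}_q)$ is equivalent over $\mathbb F_q$ to one of $x^3$, $(x^3+3\sigma x)/(3x^2+\sigma)$, $x^3-3x$, or $x^3-3\sigma x$.
   Context: A rational expression $R(x)=g(x)/h(x)$ with $g,h$ coprime has degree $\max(\deg g,\deg h)$; cubic means degree $3$. The group $G(\mathbb F_q)=\mathrm{PGL}_2(\mathbb F_q)\times\mathrm{PGL}_2(\mathbb F_q)$, with $\mathrm{PGL}_2(\mathbb F_q)$ identified with the group of degree-one rational expressions (Möbius transformations) over $\mathbb F_q$ under composition, acts on $\mathbb F_q(x)$ by $(B,A)\cdot R(x)=B(R(A^{ -1}(x)))$; two expressions are equivalent over $\mathbb F_q$ if they lie in the same $G(\mathbb F_q)$-orbit. Viewing $R$ as a map $\mathbb P^1(\overline{\mathbb F}_q)\to\mathbb P^1(\overline{\mathbb F}_q)$, a ramification point is a point $P$ whose ramification index $e_R(P)$ (multiplicity of $P$ in the fibre $R^{ -1}(R(P))$) exceeds $1$. -}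

module Defs where

open import Level using (Level; _⊔_) renaming (suc to lsuc)
open import Data.Nat as ℕ using (ℕ; zero; suc)
open import Data.Unit.Polymorphic using (⊤)
open import Data.Product using (Σ; ∃; ∃-syntax; _×_; _,_)
open import Data.Sum using (_⊎_)
open import Data.List using (List; []; _∷_; _++_; [_])
open import Data.List.Relation.Unary.Any using (Any)
open import Data.Vec as Vec using (Vec; []; _∷_)
open import Relation.Nullary using (¬_)
open import Relation.Binary.PropositionalEquality using (_≢_)
open import Data.Fin using (Fin)
open import Relation.Binary using (Decidable)
open import Algebra.Bundles using (CommutativeRing)
open import Algebra.Morphism.Structures using (IsRingHomomorphism)

-- Fields (the standard library has no Field bundle).
-- A field: a commutative ring with 1 ≉ 0 in which every nonzero
-- element has a multiplicative inverse; we also record decidability of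
-- equality (true classically of every field).

record Field c ℓ : Set (lsuc (c ⊔ ℓ)) where
  field
    commutativeRing : CommutativeRing c ℓ
  open CommutativeRing commutativeRing public
  field
    1≉0     : ¬ (1# ≈ 0#)
    inverse : ∀ x → ¬ (x ≈ 0#) → ∃[ y ] (x * y ≈ 1#)
    _≟_     : Decidable _≈_

-- Polynomials over a commutative ring, as coefficient lists
-- (constant term first), with coefficientwise equality up to trailing
-- zeros.

module PolyOps {c ℓ} (R : CommutativeRing c ℓ) where
  open CommutativeRing R

  Poly : Set c
  Poly = List Carrier

  infix 4 _≈ₚ_
  _≈ₚ_ : Poly → Poly → Set ℓ
  []       ≈ₚ []       = ⊤
  (x ∷ xs) ≈ₚ []       = (x ≈ 0#) × (xs ≈ₚ [])
  []       ≈ₚ (y ∷ ys) = (0# ≈ y) × ([] ≈ₚ ys)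
  (x ∷ xs) ≈ₚ (y ∷ ys) = (x ≈ y) × (xs ≈ₚ ys)

  infixl 6 _+ₚ_
  _+ₚ_ : Poly → Poly → Poly
  []       +ₚ q        = q
  (x ∷ p)  +ₚ []       = x ∷ p
  (x ∷ p)  +ₚ (y ∷ q)  = (x + y) ∷ (p +ₚ q)

  infixl 7 _·ₚ_
  _·ₚ_ : Carrier → Poly → Poly
  a ·ₚ []      = []
  a ·ₚ (x ∷ p) = (a * x) ∷ (a ·ₚ p)

  infixl 7 _*ₚ_
  _*ₚ_ : Poly → Poly → Poly
  []      *ₚ q = []
  (a ∷ p) *ₚ q = (a ·ₚ q) +ₚ (0# ∷ (p *ₚ q))

  infixr 8 _^ₚ_
  _^ₚ_ : Poly → ℕ → Poly
  p ^ₚ zero  = 1# ∷ []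
  p ^ₚ suc n = p *ₚ (p ^ₚ n)

  _∣ₚ_ : Poly → Poly → Set (c ⊔ ℓ)
  d ∣ₚ p = ∃[ q ] (d *ₚ q ≈ₚ p)

  Coprimeₚ : Poly → Poly → Set (c ⊔ ℓ)
  Coprimeₚ g h = ∀ d → d ∣ₚ g → d ∣ₚ h → d ∣ₚ (1# ∷ [])

  eval : Poly → Carrier → Carrier
  eval []      x = 0#
  eval (a ∷ p) x = a + x * eval p x

  _×1 : ℕ → Carrier
  zero  ×1 = 0#
  suc n ×1 = 1# + n ×1

IsFinite : ∀ {c ℓ} → Field c ℓ → Set (c ⊔ ℓ)
IsFinite F = ∃[ xs ] (∀ x → Any (x ≈_) xs)
  where open Field F

CharAtLeast5 : ∀ {c ℓ} → Field c ℓ → Set ℓ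
CharAtLeast5 F = ∀ n → 1 ℕ.≤ n → n ℕ.≤ 4 → ¬ (n ×1 ≈ 0#)
  where open Field F
        open PolyOps commutativeRing

IsNonSquare : ∀ {c ℓ} (F : Field c ℓ) → Field.Carrier F → Set (c ⊔ ℓ)
IsNonSquare F σ = ∀ y → ¬ (y * y ≈ σ)
  where open Field F

IsAlgClosed : ∀ {c ℓ} → Field c ℓ → Set (c ⊔ ℓ)
IsAlgClosed K = ∀ (a₀ : Carrier) (as : List Carrier) (aₙ : Carrier) →
  ¬ (aₙ ≈ 0#) → ∃[ x ] (eval (a₀ ∷ as ++ [ aₙ ]) x ≈ 0#)
  where open Field K
        open PolyOps commutativeRing

IsFieldHom : ∀ {c ℓ c' ℓ'} (F : Field c ℓ) (K : Field c' ℓ') →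
             (Field.Carrier F → Field.Carrier K) → Set (c ⊔ ℓ ⊔ ℓ')
IsFieldHom F K ι = IsRingHomomorphism (Field.rawRing F) (Field.rawRing K) ι

-- Rational expressions of degree ≤ 3: a pair (g , h) of polynomials of
-- degree ≤ 3 (4 coefficients each, constant term first), read as g/h.

module _ {c ℓ} (F : Field c ℓ) where
  open Field F
  open PolyOps commutativeRing

  record RatExpr : Set c where
    constructor _/_
    field
      num : Vec Carrier 4
      den : Vec Carrier 4

  numₚ denₚ : RatExpr → Poly
  numₚ R = Vec.toList (RatExpr.num R)
  denₚ R = Vec.toList (RatExpr.den R)

  IsCubic : RatExpr → Set (c ⊔ ℓ)
  IsCubic R = Coprimeₚ (numₚ R) (denₚ R)
            × ¬ ((Vec.lookup (RatExpr.num R) (Data.Fin.fromℕ 3) ≈ 0#)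
               × (Vec.lookup (RatExpr.den R) (Data.Fin.fromℕ 3) ≈ 0#))
    where import Data.Fin

  record Mobius : Set (c ⊔ ℓ) where
    constructor mob
    field
      a b c' d : Carrier
      det≉0 : ¬ (a * d - b * c' ≈ 0#)

  -- homogeneous substitution: for v = (g₀,…,g₃) and polynomials p, q,
  -- Σᵢ gᵢ pⁱ q³⁻ⁱ.  With p = αx+β, q = γx+δ this is the numerator of
  -- g((αx+β)/(γx+δ)) after clearing the common factor (γx+δ)³.
  homSubst : Vec Carrier 4 → Poly → Poly → Poly
  homSubst (g₀ ∷ g₁ ∷ g₂ ∷ g₃ ∷ []) p q =
    (g₀ ·ₚ (q ^ₚ 3)) +ₚ (g₁ ·ₚ (p *ₚ q ^ₚ 2)) +ₚ (g₂ ·ₚ (p ^ₚ 2 *ₚ q)) +ₚ (g₃ ·ₚ (p ^ₚ 3))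

  -- the action (B , A) · R = B ∘ R ∘ A⁻¹, returned as (numerator , denominator).
  -- A⁻¹ for A = (a x + b)/(c x + d) is (d x - b)/(- c x + a).
  -- R ∘ A⁻¹ = G(d x - b , - c x + a) / H(d x - b , - c x + a), and
  -- B ∘ (N/D) = (a' N + b' D)/(c' N + d' D) for B = (a' x + b')/(c' x + d').
  act : Mobius → Mobius → RatExpr → Poly × Poly
  act (mob a' b' c'' d' _) (mob a b c' d _) R =
    ((a' ·ₚ N) +ₚ (b' ·ₚ D)) , ((c'' ·ₚ N) +ₚ (d' ·ₚ D))
    where
      p q N D : Poly
      p = (- b) ∷ d ∷ []
      q = a ∷ (- c') ∷ []
      N = homSubst (RatExpr.num R) p q
      D = homSubst (RatExpr.den R) p q

  _≈ᵣ_ : Poly × Poly → Poly × Poly → Set ℓ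
  (N , D) ≈ᵣ (N' , D') = N *ₚ D' ≈ₚ N' *ₚ D

  EquivalentOver : RatExpr → RatExpr → Set (c ⊔ ℓ)
  EquivalentOver R R' = ∃[ B ] ∃[ A ] (act B A R ≈ᵣ (numₚ R' , denₚ R'))

  three : Carrier
  three = 3 ×1

  nf₁ : RatExpr
  nf₁ = (0# ∷ 0# ∷ 0# ∷ 1# ∷ []) / (1# ∷ 0# ∷ 0# ∷ 0# ∷ [])

  nf₂ : Carrier → RatExpr
  nf₂ σ = (0# ∷ three * σ ∷ 0# ∷ 1# ∷ []) / (σ ∷ 0# ∷ three ∷ 0# ∷ [])

  nf₃ : RatExpr
  nf₃ = (0# ∷ - three ∷ 0# ∷ 1# ∷ []) / (1# ∷ 0# ∷ 0# ∷ 0# ∷ [])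

  nf₄ : Carrier → RatExpr
  nf₄ σ = (0# ∷ - (three * σ) ∷ 0# ∷ 1# ∷ []) / (1# ∷ 0# ∷ 0# ∷ 0# ∷ [])

-- Ramification over an extension field K (in the theorem, an
-- algebraically closed field containing F, i.e. containing F̄_q).
-- R = g/h of degree 3 corresponds to the map [X : Y] ↦ [G(X,Y) : H(X,Y)]
-- on P¹(K), where G(X,Y) = Σ gᵢ Xⁱ Y³⁻ⁱ, H likewise (the point x is
-- [x : 1], ∞ is [1 : 0]).  Binary forms of degree n are coefficient
-- lists (coefficient of Xⁱ Yⁿ⁻ⁱ at position i); their product is the
-- list convolution _*ₚ_.

module _ {c ℓ c' ℓ'} (F : Field c ℓ) (K : Field c' ℓ')
         (ι : Field.Carrier F → Field.Carrier K) where
  open Field K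
  open PolyOps commutativeRing

  record P¹ : Set (c' ⊔ ℓ') where
    constructor [_∶_]⟨_⟩
    field
      X Y : Carrier
      nonzero : ¬ ((X ≈ 0#) × (Y ≈ 0#))

  SameP : P¹ → P¹ → Set ℓ'
  SameP [ a ∶ b ]⟨ _ ⟩ [ a' ∶ b' ]⟨ _ ⟩ = a * b' ≈ a' * b

  hEval : Vec Carrier 4 → Carrier → Carrier → Carrier
  hEval (g₀ ∷ g₁ ∷ g₂ ∷ g₃ ∷ []) a b =
    g₀ * (b * b * b) + g₁ * (a * b * b) + g₂ * (a * a * b) + g₃ * (a * a * a)

  -- the cubic form d·G - c·H whose zeros (with multiplicity) form the
  -- fibre R⁻¹(R(P)), where R(P) = [c : d] = [G(a,b) : H(a,b)]
  fibreForm : RatExpr F → P¹ → Poly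
  fibreForm R [ a ∶ b ]⟨ _ ⟩ =
    (hEval H a b ·ₚ Vec.toList G) +ₚ ((- hEval G a b) ·ₚ Vec.toList H)
    where
      G H : Vec Carrier 4
      G = Vec.map ι (RatExpr.num R)
      H = Vec.map ι (RatExpr.den R)

  -- P = [a : b] is a ramification point: its multiplicity e_R(P) in the
  -- fibre is > 1, i.e. (b X - a Y)² divides the fibre form.
  -- (b X - a Y)² = a² Y² - 2ab XY + b² X²; a linear form u X + v Y is [v , u].
  IsRamificationPoint : RatExpr F → P¹ → Set (c' ⊔ ℓ')
  IsRamificationPoint R P@([ a ∶ b ]⟨ _ ⟩) =
    ∃[ u ] ∃[ v ]
      (((a * a) ∷ (- ((1# + 1#) * a * b)) ∷ (b * b) ∷ []) *ₚ (v ∷ u ∷ [])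
        ≈ₚ fibreForm R P)

  AtMostThreeRamificationPoints : RatExpr F → Set (c' ⊔ ℓ')
  AtMostThreeRamificationPoints R =
    ¬ (Σ (Fin 4 → P¹) λ P → ((∀ i → IsRamificationPoint R (P i))
               × (∀ i j → i ≢ j → ¬ SameP (P i) (P j))))

{-# OPTIONS --safe #-}
module Submission where

-- Write R = G/H and let W = G H′ - G′ H be the Wronskian, a binary quartic whose
-- roots are the ramification points.  It has degree four, so at most three
-- distinct roots means a double root P, and since char F ≥ 5 a double root is a
-- point with e_R(P) = 3: the pencil spanned by G and H contains the cube of the
-- linear form vanishing at P.
--
-- If P is rational, move it and its image to ∞: R becomes a cubic polynomial,
-- and completing the cube gives x³ + k x, hence x³ or x³ - 3 t x with t or t/σ
-- a square (F is finite).
--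
-- If P is not rational, elimination shows that P is a root of a quadratic
-- polynomial over F which determines the pencil: after a rational substitution
-- it is spanned by the two components of (x - √σ)³.
--
-- No Galois theory is needed: "P ∉ F" is used only in the form that a
-- polynomial of degree ≤ 1 over F vanishing at P is zero.

-- Composing R on the left with a Möbius map changes only the basis of the span of G and H, so the
-- data that matter are the minors `pᵢⱼ` of the coefficient matrix, and W is linear in them. With Gᵢ
-- the i-th derivative over i!, the matrix with rows (G, G₁, G₂) and (H, H₁, H₂) has minors W, W′/2
-- and G₁H₂ - G₂H₁. At a double root of W the first two vanish, and so does the third because G and
-- H have no common root. The rows are then parallel: some member of the pencil vanishes to order
-- three.
--
-- For irrational P, cancelling leading terms among these minors leaves a quadratic `V` and a linear
-- `U` that still vanish at P. Hence `U` is zero; its coefficients, those of `V` and the Plücker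
-- relation fix all `pᵢⱼ` up to a common factor. They are those of `nf₂ σ` after a substitution,
-- since its numerator ± √σ times its denominator is (x ± √σ)³.
--
-- Two obstacles shape the rest. Coprimality is given over F only, so the absence of common roots in
-- K needs a proof; and a root of W at infinity lowers its degree as a polynomial.

open import Defs
open import Level using (_⊔_; 0ℓ)
open import Algebra.Bundles using (CommutativeRing)
open import Algebra.Morphism.Structures using (IsRingHomomorphism)
import Algebra.Properties.AbelianGroup as AbelianGroupProperties
import Algebra.Properties.Group as GroupProperties
import Algebra.Properties.Ring as RingProperties
import Algebra.Properties.Semiring.Mult.TCOptimised as Mult
import Algebra.Solver.Ring as RingSolver
open import Algebra.Solver.Ring.AlmostCommutativeRing
  using (fromCommutativeRing; _-Raw-AlmostCommutative⟶_)
open import Data.Bool using (Bool; true; false; T; _∧_)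
open import Data.Empty using (⊥; ⊥-elim)
open import Data.Fin as Fin using (Fin; zero; suc; toℕ; fromℕ<)
import Data.Fin.Properties as Fin
open import Data.Integer as ℤ using (ℤ; +_; -[1+_])
import Data.Integer.Properties as ℤ
open import Data.List as List using (List; []; _∷_; [_]; _++_; replicate)
open import Data.List.Relation.Binary.Pointwise as Pointwise using (Pointwise; []; _∷_)
open import Data.List.Relation.Unary.Any as Any using (Any; here; there)
open import Data.Maybe using (Maybe; just; nothing; is-just)
open import Data.Nat as ℕ using (ℕ; zero; suc; s≤s; z≤n)
import Data.Nat.Properties as ℕ
open import Data.Product using (_×_; _,_; proj₁; proj₂; ∃-syntax; Σ)
open import Data.Sum using (_⊎_; inj₁; inj₂)
import Data.Sum as Sum
open import Data.Unit using (⊤; tt)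
open import Data.Vec as Vec using (Vec; []; _∷_)
open import Data.Vec.N-ary using (N-ary; _$ⁿ_)
open import Relation.Binary.PropositionalEquality as ≡ using (_≡_; _≢_)
open import Relation.Nullary using (¬_; Dec; yes; no)

-- A ring solver with integer coefficients

module IntegerSolver {c ℓ} (R : CommutativeRing c ℓ) where
  open CommutativeRing R
  open RingProperties ring using (-‿distribˡ-*; -‿distribʳ-*; -‿involutive; -0#≈0#)
  open AbelianGroupProperties +-abelianGroup using (⁻¹-∙-comm)
  open Mult semiring using (×1-homo-*; ×-homo-+; 1+×) renaming (_×_ to _×′_)
  open import Relation.Binary.Reasoning.Setoid setoid

  fromℤ : ℤ → Carrier
  fromℤ (+ n)    = n ×′ 1#
  fromℤ -[1+ n ] = - (suc n ×′ 1#)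

  private
    cancel-1 : ∀ x y → (1# + x) - (1# + y) ≈ x - y
    cancel-1 x y = begin
      (1# + x) - (1# + y)        ≈⟨ +-congˡ (⁻¹-∙-comm 1# y) ⟨
      (1# + x) + (- 1# + - y)    ≈⟨ +-assoc (1# + x) (- 1#) (- y) ⟨
      (1# + x) - 1# - y          ≈⟨ +-congʳ (+-congʳ (+-comm 1# x)) ⟩
      (x + 1#) - 1# - y          ≈⟨ +-congʳ (+-assoc x 1# (- 1#)) ⟩
      x + (1# - 1#) - y          ≈⟨ +-congʳ (+-congˡ (-‿inverseʳ 1#)) ⟩
      x + 0# - y                 ≈⟨ +-congʳ (+-identityʳ x) ⟩
      x - y                      ∎

    ⊖-homo : ∀ m n → fromℤ (m ℤ.⊖ n) ≈ m ×′ 1# - n ×′ 1#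
    ⊖-homo m       zero    = sym (trans (+-congˡ -0#≈0#) (+-identityʳ _))
    ⊖-homo zero    (suc n) = sym (+-identityˡ _)
    ⊖-homo (suc m) (suc n) = begin
      fromℤ (suc m ℤ.⊖ suc n)            ≡⟨ ≡.cong fromℤ (ℤ.[1+m]⊖[1+n]≡m⊖n m n) ⟩
      fromℤ (m ℤ.⊖ n)                    ≈⟨ ⊖-homo m n ⟩
      m ×′ 1# - n ×′ 1#                  ≈⟨ cancel-1 _ _ ⟨
      (1# + m ×′ 1#) - (1# + n ×′ 1#)    ≈⟨ +-cong (1+× m 1#) (-‿cong (1+× n 1#)) ⟨
      suc m ×′ 1# - suc n ×′ 1#          ∎

    +-homo : ∀ i j → fromℤ (i ℤ.+ j) ≈ fromℤ i + fromℤ j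
    +-homo (+ m)    (+ n)    = ×-homo-+ 1# m n
    +-homo (+ m)    -[1+ n ] = ⊖-homo m (suc n)
    +-homo -[1+ m ] (+ n)    = trans (⊖-homo n (suc m)) (+-comm _ _)
    +-homo -[1+ m ] -[1+ n ] = begin
      - (suc (suc (m ℕ.+ n)) ×′ 1#)    ≡⟨ ≡.cong (λ k → - (suc k ×′ 1#)) (ℕ.+-suc m n) ⟨
      - ((suc m ℕ.+ suc n) ×′ 1#)      ≈⟨ -‿cong (×-homo-+ 1# (suc m) (suc n)) ⟩
      - (suc m ×′ 1# + suc n ×′ 1#)    ≈⟨ ⁻¹-∙-comm _ _ ⟨
      - (suc m ×′ 1#) - suc n ×′ 1#    ∎

    -‿homo : ∀ i → fromℤ (ℤ.- i) ≈ - fromℤ i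
    -‿homo (+ zero)   = sym -0#≈0#
    -‿homo (+ suc n)  = refl
    -‿homo -[1+ n ]   = sym (-‿involutive _)

    *-homo⁺ : ∀ m j → fromℤ (+ m ℤ.* j) ≈ fromℤ (+ m) * fromℤ j
    *-homo⁺ m (+ n)    = begin
      fromℤ (+ m ℤ.* + n)        ≡⟨ ≡.cong fromℤ (ℤ.pos-* m n) ⟨
      (m ℕ.* n) ×′ 1#            ≈⟨ ×1-homo-* m n ⟩
      (m ×′ 1#) * (n ×′ 1#)      ∎
    *-homo⁺ m -[1+ n ] = begin
      fromℤ (+ m ℤ.* ℤ.- (+ suc n))    ≡⟨ ≡.cong fromℤ (ℤ.neg-distribʳ-* (+ m) (+ suc n)) ⟨
      fromℤ (ℤ.- (+ m ℤ.* + suc n))    ≈⟨ -‿homo (+ m ℤ.* + suc n) ⟩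
      - fromℤ (+ m ℤ.* + suc n)        ≈⟨ -‿cong (*-homo⁺ m (+ suc n)) ⟩
      - (fromℤ (+ m) * fromℤ (+ suc n)) ≈⟨ -‿distribʳ-* _ _ ⟩
      fromℤ (+ m) * fromℤ -[1+ n ]     ∎

    *-homo : ∀ i j → fromℤ (i ℤ.* j) ≈ fromℤ i * fromℤ j
    *-homo (+ m)    j = *-homo⁺ m j
    *-homo -[1+ m ] j = begin
      fromℤ (ℤ.- (+ suc m) ℤ.* j)      ≡⟨ ≡.cong fromℤ (ℤ.neg-distribˡ-* (+ suc m) j) ⟨
      fromℤ (ℤ.- (+ suc m ℤ.* j))      ≈⟨ -‿homo (+ suc m ℤ.* j) ⟩
      - fromℤ (+ suc m ℤ.* j)          ≈⟨ -‿cong (*-homo⁺ (suc m) j) ⟩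
      - (fromℤ (+ suc m) * fromℤ j)    ≈⟨ -‿distribˡ-* _ _ ⟩
      fromℤ -[1+ m ] * fromℤ j         ∎

    ℤ-morphism : ℤ.+-*-rawRing -Raw-AlmostCommutative⟶ fromCommutativeRing R
    ℤ-morphism = record
      { ⟦_⟧    = fromℤ
      ; +-homo = +-homo
      ; *-homo = *-homo
      ; -‿homo = -‿homo
      ; 0-homo = refl
      ; 1-homo = refl
      }

    fromℤ-weaklyDecidable : ∀ i j → Maybe (fromℤ i ≈ fromℤ j)
    fromℤ-weaklyDecidable i j with i ℤ.≟ j
    ... | yes i≡j = just (reflexive (≡.cong fromℤ i≡j))
    ... | no  _   = nothing

  open RingSolver ℤ.+-*-rawRing (fromCommutativeRing R) ℤ-morphism fromℤ-weaklyDecidable public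
    using (Polynomial; _:=_; _:+_; _:*_; _:-_; :-_; con; ⟦_⟧)
  open RingSolver ℤ.+-*-rawRing (fromCommutativeRing R) ℤ-morphism fromℤ-weaklyDecidable
    using (var; normalise; _≟N_; ⟦_⟧N-cong; correct)

  close : ∀ {n a} {A : Set a} → N-ary n (Polynomial n) A → A
  close {n} f = f $ⁿ Vec.map var (Vec.allFin n)

  private
    equal? : ∀ {n} → Polynomial n → Polynomial n → Bool
    equal? p q = is-just (normalise p ≟N normalise q)

    equal-sound : ∀ {n} (p q : Polynomial n) → T (equal? p q) → ∀ ρ → ⟦ p ⟧ ρ ≈ ⟦ q ⟧ ρ
    equal-sound p q _ ρ with normalise p ≟N normalise q
    ... | just p≈q = trans (sym (correct p ρ)) (trans (⟦ p≈q ⟧N-cong ρ) (correct q ρ))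

  -- Checking the closed normal forms with a boolean is far cheaper than
  -- unifying their denotations in R.
  solve : ∀ n (f : N-ary n (Polynomial n) (Polynomial n × Polynomial n))
    {_ : T (equal? (proj₁ (close {n} f)) (proj₂ (close {n} f)))}
    (ρ : Vec Carrier n) → ⟦ proj₁ (close {n} f) ⟧ ρ ≈ ⟦ proj₂ (close {n} f) ⟧ ρ
  solve n f {t} = equal-sound (proj₁ (close {n} f)) (proj₂ (close {n} f)) t

  -- The ring of solver expressions, with the indiscrete equality: it allows
  -- a formula written for arbitrary commutative rings to be used as an
  -- input of the solver.
  expressions : ℕ → CommutativeRing 0ℓ 0ℓ
  expressions n = record
    { Carrier = Polynomial n
    ; _≈_ = λ _ _ → ⊤
    ; _+_ = _:+_
    ; _*_ = _:*_
    ; -_  = :-_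
    ; 0#  = con (+ 0)
    ; 1#  = con (+ 1)
    ; isCommutativeRing = record
      { isRing = record
        { +-isAbelianGroup = record
          { isGroup = record
            { isMonoid = record
              { isSemigroup = record
                { isMagma = record
                  { isEquivalence = record { refl = tt ; sym = λ _ → tt ; trans = λ _ _ → tt }
                  ; ∙-cong = λ _ _ → tt
                  }
                ; assoc = λ _ _ _ → tt
                }
              ; identity = (λ _ → tt) , (λ _ → tt)
              }
            ; inverse = (λ _ → tt) , (λ _ → tt)
            ; ⁻¹-cong = λ _ → tt
            }
          ; comm = λ _ _ → tt
          }
        ; *-cong = λ _ _ → tt
        ; *-assoc = λ _ _ _ → tt
        ; *-identity = (λ _ → tt) , (λ _ → tt)
        ; distrib = (λ _ _ _ → tt) , (λ _ _ _ → tt)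
        }
      ; *-comm = λ _ _ → tt
      }
    }

  private
    equals? : ∀ {n} → List (Polynomial n) → List (Polynomial n) → Bool
    equals? []       []       = true
    equals? (p ∷ ps) (q ∷ qs) = equal? p q ∧ equals? ps qs
    equals? _        _        = false

    ∧-T : ∀ a {b} → T (a ∧ b) → T a × T b
    ∧-T true t = tt , t

  open PolyOps R using (Poly)

  ⟦_⟧ₚ : ∀ {n} → List (Polynomial n) → Vec Carrier n → Poly
  ⟦ ps ⟧ₚ ρ = List.map (λ p → ⟦ p ⟧ ρ) ps

  private
    equals-sound : ∀ {n} (ps qs : List (Polynomial n)) → T (equals? ps qs) →
      ∀ ρ → Pointwise _≈_ (⟦ ps ⟧ₚ ρ) (⟦ qs ⟧ₚ ρ)
    equals-sound []       []       _ ρ = []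
    equals-sound (p ∷ ps) (q ∷ qs) t ρ with ∧-T (equal? p q) t
    ... | t₁ , t₂ = equal-sound p q t₁ ρ ∷ equals-sound ps qs t₂ ρ

  solveₚ : ∀ n (f : N-ary n (Polynomial n) (List (Polynomial n) × List (Polynomial n)))
    {_ : T (equals? (proj₁ (close {n} f)) (proj₂ (close {n} f)))}
    (ρ : Vec Carrier n) → Pointwise _≈_ (⟦ proj₁ (close {n} f) ⟧ₚ ρ) (⟦ proj₂ (close {n} f) ⟧ₚ ρ)
  solveₚ n f {t} = equals-sound (proj₁ (close {n} f)) (proj₂ (close {n} f)) t

-- Polynomials, roots and field extensions

module PolyEvaluation {c ℓ} (R : CommutativeRing c ℓ) where
  open CommutativeRing R
  open PolyOps R
  open IntegerSolver R

  deriv : Poly → Poly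
  deriv []      = []
  deriv (a ∷ p) = p +ₚ (0# ∷ deriv p)

  eval-congʳ : ∀ p {x y} → x ≈ y → eval p x ≈ eval p y
  eval-congʳ []      x≈y = refl
  eval-congʳ (a ∷ p) x≈y = +-congˡ (*-cong x≈y (eval-congʳ p x≈y))

  eval-+ : ∀ p q x → eval (p +ₚ q) x ≈ eval p x + eval q x
  eval-+ []      q       x = sym (+-identityˡ _)
  eval-+ (a ∷ p) []      x = sym (+-identityʳ _)
  eval-+ (a ∷ p) (b ∷ q) x = trans (+-congˡ (*-congˡ (eval-+ p q x)))
    (solve 5 (λ a b x y z → a :+ b :+ x :* (y :+ z) := (a :+ x :* y) :+ (b :+ x :* z))
      (a ∷ b ∷ x ∷ eval p x ∷ eval q x ∷ []))

  eval-deriv-∷ : ∀ a p x → eval (deriv (a ∷ p)) x ≈ eval p x + x * eval (deriv p) x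
  eval-deriv-∷ a p x = trans (eval-+ p (0# ∷ deriv p) x) (+-congˡ (+-identityˡ _))

  DoubleRoot : Poly → Carrier → Set ℓ
  DoubleRoot p x = eval p x ≈ 0# × eval (deriv p) x ≈ 0#

module SyntheticDivision {c ℓ} (R : CommutativeRing c ℓ) (r t : CommutativeRing.Carrier R) where
  open CommutativeRing R
  open PolyOps R
  open PolyEvaluation R
  open IntegerSolver R
  open import Relation.Binary.Reasoning.Setoid setoid

  -- The leading coefficient `t` is kept apart because division by the monic X - r preserves it: an
  -- induction on the degree then carries a single hypothesis `t ≉ 0`. The shape is the one that
  -- `IsAlgClosed` expects.
  withTop : ∀ {n} → Vec Carrier n → Poly
  withTop as = Vec.toList as ++ [ t ]

  -- The quotient of a ∷ withTop as by X − r is withTop (quotient as).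
  quotient : ∀ {n} → Vec Carrier n → Vec Carrier n
  quotient []       = []
  quotient (a ∷ as) = eval (withTop (a ∷ as)) r ∷ quotient as

  eval-quotient : ∀ {n} a (as : Vec Carrier n) x →
    eval (a ∷ withTop as) x ≈ (x - r) * eval (withTop (quotient as)) x + eval (a ∷ withTop as) r
  eval-quotient a [] x =
    solve 4 (λ a t r x →
        a :+ x :* (t :+ x :* con (+ 0)) :=
        (x :- r) :* (t :+ x :* con (+ 0)) :+ (a :+ r :* (t :+ r :* con (+ 0))))
      (a ∷ t ∷ r ∷ x ∷ [])
  eval-quotient a (b ∷ bs) x = trans (+-congˡ (*-congˡ (eval-quotient b bs x)))
    (solve 5 (λ a r x p q →
        a :+ x :* ((x :- r) :* q :+ p) := (x :- r) :* (p :+ x :* q) :+ (a :+ r :* p))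
      (a ∷ r ∷ x ∷ eval (b ∷ withTop bs) r ∷ eval (withTop (quotient bs)) x ∷ []))

  eval-deriv-quotient : ∀ {n} a (as : Vec Carrier n) x →
    eval (deriv (a ∷ withTop as)) x ≈
      eval (withTop (quotient as)) x + (x - r) * eval (deriv (withTop (quotient as))) x
  eval-deriv-quotient a [] x =
    solve 3 (λ t r x →
        (t :+ con (+ 0)) :+ x :* (con (+ 0) :+ x :* con (+ 0)) :=
        (t :+ x :* con (+ 0)) :+ (x :- r) :* (con (+ 0) :+ x :* con (+ 0)))
      (t ∷ r ∷ x ∷ [])
  eval-deriv-quotient a (b ∷ bs) x = begin
    eval (deriv (a ∷ withTop (b ∷ bs))) x
      ≈⟨ eval-deriv-∷ a (withTop (b ∷ bs)) x ⟩
    eval (b ∷ withTop bs) x + x * eval (deriv (b ∷ withTop bs)) x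
      ≈⟨ +-cong (eval-quotient b bs x) (*-congˡ (eval-deriv-quotient b bs x)) ⟩
    (x - r) * q + p + x * (q + (x - r) * q′)
      ≈⟨ solve 5 (λ r x p q q′ →
             ((x :- r) :* q :+ p) :+ x :* (q :+ (x :- r) :* q′) :=
             (p :+ x :* q) :+ (x :- r) :* (q :+ x :* q′))
           (r ∷ x ∷ p ∷ q ∷ q′ ∷ []) ⟩
    p + x * q + (x - r) * (q + x * q′)
      ≈⟨ +-congˡ (*-congˡ (eval-deriv-∷ p (withTop (quotient bs)) x)) ⟨
    eval (withTop (quotient (b ∷ bs))) x + (x - r) * eval (deriv (withTop (quotient (b ∷ bs)))) x ∎
    where
    p  = eval (b ∷ withTop bs) r
    q  = eval (withTop (quotient bs)) x
    q′ = eval (deriv (withTop (quotient bs))) x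

module FieldProperties {c ℓ} (F : Field c ℓ) where
  open Field F
  open PolyOps commutativeRing
  open PolyEvaluation commutativeRing
  open IntegerSolver commutativeRing
  open RingProperties ring public using (x∙y⁻¹≈ε⇒x≈y; -0#≈0#)
  open import Relation.Binary.Reasoning.Setoid setoid

  x≈y⇒x-y≈0 : ∀ {x y} → x ≈ y → x - y ≈ 0#
  x≈y⇒x-y≈0 x≈y = trans (+-congʳ x≈y) (-‿inverseʳ _)

  *-cancelˡ : ∀ {x y z} → ¬ x ≈ 0# → x * y ≈ x * z → y ≈ z
  *-cancelˡ {x} {y} {z} x≉0 xy≈xz with x⁻¹ , x*x⁻¹≈1 ← inverse x x≉0 = begin
    y                ≈⟨ undo y ⟨
    x⁻¹ * (x * y)    ≈⟨ *-congˡ xy≈xz ⟩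
    x⁻¹ * (x * z)    ≈⟨ undo z ⟩
    z                ∎
    where
    undo : ∀ w → x⁻¹ * (x * w) ≈ w
    undo w = begin
      x⁻¹ * (x * w)  ≈⟨ solve 3 (λ x i w → i :* (x :* w) := (x :* i) :* w) (x ∷ x⁻¹ ∷ w ∷ []) ⟩
      x * x⁻¹ * w    ≈⟨ *-congʳ x*x⁻¹≈1 ⟩
      1# * w         ≈⟨ *-identityˡ w ⟩
      w              ∎

  x*y≈0⇒y≈0 : ∀ {x y} → ¬ x ≈ 0# → x * y ≈ 0# → y ≈ 0#
  x*y≈0⇒y≈0 x≉0 xy≈0 = *-cancelˡ x≉0 (trans xy≈0 (sym (zeroʳ _)))

  x*y≉0 : ∀ {x y} → ¬ x ≈ 0# → ¬ y ≈ 0# → ¬ x * y ≈ 0#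
  x*y≉0 x≉0 y≉0 xy≈0 = y≉0 (x*y≈0⇒y≈0 x≉0 xy≈0)

  x*x≈0⇒x≈0 : ∀ {x} → x * x ≈ 0# → x ≈ 0#
  x*x≈0⇒x≈0 {x} xx≈0 with x ≟ 0#
  ... | yes x≈0 = x≈0
  ... | no  x≉0 = x*y≈0⇒y≈0 x≉0 xx≈0

  x≈0⇒x*y≈0 : ∀ {x y} → x ≈ 0# → x * y ≈ 0#
  x≈0⇒x*y≈0 x≈0 = trans (*-congʳ x≈0) (zeroˡ _)

  y≈0⇒x*y≈0 : ∀ {x y} → y ≈ 0# → x * y ≈ 0#
  y≈0⇒x*y≈0 y≈0 = trans (*-congˡ y≈0) (zeroʳ _)

  x+y≈0 : ∀ {x y} → x ≈ 0# → y ≈ 0# → x + y ≈ 0#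
  x+y≈0 x≈0 y≈0 = trans (+-cong x≈0 y≈0) (+-identityˡ 0#)

  DistinctRoots : Poly → ℕ → Set (c ⊔ ℓ)
  DistinctRoots p n = Σ (Fin n → Carrier) λ xs →
    (∀ i → eval p (xs i) ≈ 0#) × (∀ i j → xs i ≈ xs j → i ≡ j)

  -- Split off one root r and apply induction to the quotient q. A double root of q remains one, and
  -- r is double if it recurs among the roots of q; otherwise r is distinct from the n roots already
  -- found.
  doubleRoot-or-distinctRoots : IsAlgClosed F → ∀ {n} (as : Vec Carrier n) t → ¬ t ≈ 0# →
    (∃[ x ] DoubleRoot (Vec.toList as ++ [ t ]) x) ⊎ DistinctRoots (Vec.toList as ++ [ t ]) n
  doubleRoot-or-distinctRoots closed [] t t≉0 = inj₂ ((λ ()) , (λ ()) , (λ ()))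
  doubleRoot-or-distinctRoots closed {suc n} (a ∷ as) t t≉0
    with r , fr≈0 ← closed a (Vec.toList as) t t≉0
    with doubleRoot-or-distinctRoots closed (SyntheticDivision.quotient commutativeRing r t as) t t≉0
  ... | inj₁ (x , qx≈0 , q′x≈0) = inj₁ (x ,
          trans (eval-quotient a as x) (x+y≈0 (y≈0⇒x*y≈0 qx≈0) fr≈0) ,
          trans (eval-deriv-quotient a as x) (x+y≈0 qx≈0 (y≈0⇒x*y≈0 q′x≈0)))
    where open SyntheticDivision commutativeRing r t
  ... | inj₂ (xs , roots , distinct) with Fin.any? (λ i → xs i ≟ r)
  ... | yes (i , xᵢ≈r) = inj₁ (r , fr≈0 ,
          trans (eval-deriv-quotient a as r)
            (x+y≈0 (trans (eval-congʳ (withTop (quotient as)) (sym xᵢ≈r)) (roots i))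
              (x≈0⇒x*y≈0 (-‿inverseʳ r))))
    where open SyntheticDivision commutativeRing r t
  ... | no  r∉xs = inj₂ (xs′ , roots′ , distinct′)
    where
    open SyntheticDivision commutativeRing r t

    xs′ : Fin (suc n) → Carrier
    xs′ zero    = r
    xs′ (suc i) = xs i

    roots′ : ∀ i → eval (a ∷ withTop as) (xs′ i) ≈ 0#
    roots′ zero    = fr≈0
    roots′ (suc i) = trans (eval-quotient a as (xs i)) (x+y≈0 (y≈0⇒x*y≈0 (roots i)) fr≈0)

    distinct′ : ∀ i j → xs′ i ≈ xs′ j → i ≡ j
    distinct′ zero    zero    _    = ≡.refl
    distinct′ zero    (suc j) r≈xⱼ = ⊥-elim (r∉xs (j , sym r≈xⱼ))
    distinct′ (suc i) zero    xᵢ≈r = ⊥-elim (r∉xs (i , xᵢ≈r))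
    distinct′ (suc i) (suc j) x≈x  = ≡.cong suc (distinct i j x≈x)

module Extension {c ℓ c' ℓ'} (F : Field c ℓ) (K : Field c' ℓ')
  (ι : Field.Carrier F → Field.Carrier K) (ι-hom : IsFieldHom F K ι) where
  private
    module F = Field F
    module K = Field K
    module Fₚ = PolyOps F.commutativeRing
    module Kₚ = PolyOps K.commutativeRing
    open PolyEvaluation
  open Fₚ using (Poly; _+ₚ_; _·ₚ_; _*ₚ_; _≈ₚ_)
  open K using (_≈_; _+_; _*_; -_; _-_; 0#; 1#; refl; sym; trans; +-cong; *-cong; +-congˡ; *-congˡ)
  open IsRingHomomorphism ι-hom public using (⟦⟧-cong; +-homo; *-homo; -‿homo; 0#-homo; 1#-homo)
  open FieldProperties K
  open IntegerSolver K.commutativeRing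

  ι-injective : ∀ {x} → ι x ≈ 0# → x F.≈ F.0#
  ι-injective {x} ιx≈0 with x F.≟ F.0#
  ... | yes x≈0 = x≈0
  ... | no  x≉0 with y , xy≈1 ← F.inverse x x≉0 = ⊥-elim (K.1≉0
          (trans (sym (trans (⟦⟧-cong xy≈1) 1#-homo)) (trans (*-homo x y) (x≈0⇒x*y≈0 ιx≈0))))

  evalAt : K.Carrier → Poly → K.Carrier
  evalAt x p = Kₚ.eval (List.map ι p) x

  module _ (x : K.Carrier) where
    evalAt-cong : ∀ p q → p ≈ₚ q → evalAt x p ≈ evalAt x q
    evalAt-cong []      []      _          = refl
    evalAt-cong []      (b ∷ q) (0≈b , qs) = sym (evalAt-cong-[] b q (F.sym 0≈b) (sym (evalAt-cong [] q qs)))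
      where
      evalAt-cong-[] : ∀ a p → a F.≈ F.0# → evalAt x p ≈ 0# → evalAt x (a ∷ p) ≈ 0#
      evalAt-cong-[] a p a≈0 p≈0 = x+y≈0 (trans (⟦⟧-cong a≈0) 0#-homo) (y≈0⇒x*y≈0 p≈0)
    evalAt-cong (a ∷ p) []      (a≈0 , ps) =
      x+y≈0 (trans (⟦⟧-cong a≈0) 0#-homo) (y≈0⇒x*y≈0 (evalAt-cong p [] ps))
    evalAt-cong (a ∷ p) (b ∷ q) (a≈b , ps) = +-cong (⟦⟧-cong a≈b) (*-congˡ (evalAt-cong p q ps))

    evalAt-+ : ∀ p q → evalAt x (p +ₚ q) ≈ evalAt x p + evalAt x q
    evalAt-+ []      q       = sym (K.+-identityˡ _)
    evalAt-+ (a ∷ p) []      = sym (K.+-identityʳ _)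
    evalAt-+ (a ∷ p) (b ∷ q) = trans (+-cong (+-homo a b) (*-congˡ (evalAt-+ p q)))
      (solve 5 (λ a b x y z → a :+ b :+ x :* (y :+ z) := (a :+ x :* y) :+ (b :+ x :* z))
        (ι a ∷ ι b ∷ x ∷ evalAt x p ∷ evalAt x q ∷ []))

    evalAt-· : ∀ a p → evalAt x (a ·ₚ p) ≈ ι a * evalAt x p
    evalAt-· a []      = sym (K.zeroʳ _)
    evalAt-· a (b ∷ p) = trans (+-cong (*-homo a b) (*-congˡ (evalAt-· a p)))
      (solve 4 (λ a b x y → a :* b :+ x :* (a :* y) := a :* (b :+ x :* y))
        (ι a ∷ ι b ∷ x ∷ evalAt x p ∷ []))

    evalAt-shift : ∀ p → evalAt x (F.0# ∷ p) ≈ x * evalAt x p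
    evalAt-shift p = trans (K.+-congʳ 0#-homo) (K.+-identityˡ _)

    evalAt-* : ∀ p q → evalAt x (p *ₚ q) ≈ evalAt x p * evalAt x q
    evalAt-* []      q = sym (K.zeroˡ _)
    evalAt-* (a ∷ p) q = trans (evalAt-+ (a ·ₚ q) (F.0# ∷ p *ₚ q))
      (trans (+-cong (evalAt-· a q) (trans (evalAt-shift (p *ₚ q)) (*-congˡ (evalAt-* p q))))
        (solve 4 (λ a x y z → a :* z :+ x :* (y :* z) := (a :+ x :* y) :* z)
          (ι a ∷ x ∷ evalAt x p ∷ evalAt x q ∷ [])))

    evalAt-deriv : ∀ p → Kₚ.eval (deriv K.commutativeRing (List.map ι p)) x ≈ evalAt x (deriv F.commutativeRing p)
    evalAt-deriv []      = refl
    evalAt-deriv (a ∷ p) = trans (eval-deriv-∷ K.commutativeRing (ι a) (List.map ι p) x)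
      (sym (trans (evalAt-+ p (F.0# ∷ deriv F.commutativeRing p))
        (+-congˡ (trans (evalAt-shift (deriv F.commutativeRing p)) (*-congˡ (sym (evalAt-deriv p)))))))

  evalAt-ι : ∀ p y → evalAt (ι y) p ≈ ι (Fₚ.eval p y)
  evalAt-ι []      y = sym 0#-homo
  evalAt-ι (a ∷ p) y = trans (+-congˡ (trans (*-congˡ (evalAt-ι p y)) (sym (*-homo y _)))) (sym (+-homo a _))

  Irrational : K.Carrier → Set _
  Irrational x = ∀ y → ¬ ι y ≈ x

  irrational-linear : ∀ {x} → Irrational x → ∀ a b → evalAt x (a ∷ b ∷ []) ≈ 0# → a F.≈ F.0# × b F.≈ F.0#
  irrational-linear {x} x∉F a b root with b F.≟ F.0#
  ... | yes b≈0 = ι-injective (trans (sym (trans (+-congˡ (y≈0⇒x*y≈0 (x+y≈0 (trans (⟦⟧-cong b≈0) 0#-homo)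
                    (K.zeroʳ x)))) (K.+-identityʳ _))) root) , b≈0
  ... | no  b≉0 with b⁻¹ , bb⁻¹≈1 ← F.inverse b b≉0 = ⊥-elim (x∉F (F.- (a F.* b⁻¹)) (begin
      ι (F.- (a F.* b⁻¹))                  ≈⟨ trans (-‿homo _) (K.-‿cong (*-homo a b⁻¹)) ⟩
      - (ι a * ι b⁻¹)                      ≈⟨ K.+-identityˡ _ ⟨
      0# - ι a * ι b⁻¹                     ≈⟨ K.+-congʳ (K.zeroˡ _) ⟨
      0# * ι b⁻¹ - ι a * ι b⁻¹             ≈⟨ K.+-congʳ (K.*-congʳ root) ⟨
      (ι a + x * (ι b + x * 0#)) * ι b⁻¹ - ι a * ι b⁻¹
        ≈⟨ solve 4 (λ a b i x → (a :+ x :* (b :+ x :* con (+ 0))) :* i :- a :* i := x :* (b :* i))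
             (ι a ∷ ι b ∷ ι b⁻¹ ∷ x ∷ []) ⟩
      x * (ι b * ι b⁻¹)                    ≈⟨ *-congˡ (trans (sym (*-homo b b⁻¹)) (trans (⟦⟧-cong bb⁻¹≈1) 1#-homo)) ⟩
      x * 1#                               ≈⟨ K.*-identityʳ x ⟩
      x                                    ∎))
    where open import Relation.Binary.Reasoning.Setoid K.setoid

-- Coefficientwise equality of polynomials

module PolyEquality {c ℓ} (R : CommutativeRing c ℓ) where
  open CommutativeRing R
  open PolyOps R

  infix 4 _≋_
  -- Unlike `≈ₚ`, which is computed by recursion, this is an inductive family: the polynomials can
  -- be inferred from a proof, and congruence is a direct induction. It is also what `solveₚ`
  -- returns.
  _≋_ : Poly → Poly → Set (c ⊔ ℓ)
  _≋_ = Pointwise _≈_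

  ≋⇒≈ₚ : ∀ {p q} → p ≋ q → p ≈ₚ q
  ≋⇒≈ₚ []       = _
  ≋⇒≈ₚ (e ∷ es) = e , ≋⇒≈ₚ es

  ≋-refl : ∀ {p} → p ≋ p
  ≋-refl = Pointwise.refl refl

  ≋-sym : ∀ {p q} → p ≋ q → q ≋ p
  ≋-sym = Pointwise.symmetric sym

  ≋-trans : ∀ {p q r} → p ≋ q → q ≋ r → p ≋ r
  ≋-trans = Pointwise.transitive trans

  +ₚ-cong : ∀ {p p′ q q′} → p ≋ p′ → q ≋ q′ → p +ₚ q ≋ p′ +ₚ q′
  +ₚ-cong []       q≋q′     = q≋q′
  +ₚ-cong (e ∷ es) []       = e ∷ es
  +ₚ-cong (e ∷ es) (f ∷ fs) = +-cong e f ∷ +ₚ-cong es fs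

  ·ₚ-cong : ∀ {a a′ p p′} → a ≈ a′ → p ≋ p′ → a ·ₚ p ≋ a′ ·ₚ p′
  ·ₚ-cong a≈a′ []       = []
  ·ₚ-cong a≈a′ (e ∷ es) = *-cong a≈a′ e ∷ ·ₚ-cong a≈a′ es

  ·ₚ-congʳ : ∀ {a a′} p → a ≈ a′ → a ·ₚ p ≋ a′ ·ₚ p
  ·ₚ-congʳ p a≈a′ = ·ₚ-cong a≈a′ (≋-refl {p})

  *ₚ-cong : ∀ {p p′ q q′} → p ≋ p′ → q ≋ q′ → p *ₚ q ≋ p′ *ₚ q′
  *ₚ-cong []       q≋q′ = []
  *ₚ-cong (e ∷ es) q≋q′ = +ₚ-cong (·ₚ-cong e q≋q′) (refl ∷ *ₚ-cong es q≋q′)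

-- Squares in a finite field

module FiniteFieldSquares {c ℓ} (F : Field c ℓ) (finite : IsFinite F) where
  open Field F
  open FieldProperties F
  open IntegerSolver commutativeRing
  open import Relation.Binary.Reasoning.Setoid setoid

  private
    elements : List Carrier
    elements = proj₁ finite

    -- The enumeration may contain repetitions up to `≈`. The position of the first occurrence is
    -- nevertheless well defined on classes; it serves both the pigeonhole argument and the choice
    -- between x and -x.
    indexIn : List Carrier → Carrier → ℕ
    indexIn []       x = 0
    indexIn (y ∷ ys) x with x ≟ y
    ... | yes _ = 0
    ... | no  _ = suc (indexIn ys x)

    indexIn-cong : ∀ ys {x y} → x ≈ y → indexIn ys x ≡ indexIn ys y
    indexIn-cong []       x≈y = ≡.refl
    indexIn-cong (z ∷ zs) {x} {y} x≈y with x ≟ z | y ≟ z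
    ... | yes _   | yes _   = ≡.refl
    ... | yes x≈z | no  y≉z = ⊥-elim (y≉z (trans (sym x≈y) x≈z))
    ... | no  x≉z | yes y≈z = ⊥-elim (x≉z (trans x≈y y≈z))
    ... | no  _   | no  _   = ≡.cong suc (indexIn-cong zs x≈y)

    indexIn-injective : ∀ {ys x y} → Any (x ≈_) ys → Any (y ≈_) ys →
      indexIn ys x ≡ indexIn ys y → x ≈ y
    indexIn-injective {z ∷ zs} {x} {y} x∈ y∈ eq with x ≟ z | y ≟ z
    ... | yes x≈z | yes y≈z = trans x≈z (sym y≈z)
    indexIn-injective (here x≈z) _ eq          | no x≉z | no _   = ⊥-elim (x≉z x≈z)
    indexIn-injective (there _)  (here y≈z) eq | no _   | no y≉z = ⊥-elim (y≉z y≈z)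
    indexIn-injective (there x∈) (there y∈) eq | no _   | no _   =
      indexIn-injective x∈ y∈ (ℕ.suc-injective eq)

    indexIn-< : ∀ {ys x} → Any (x ≈_) ys → indexIn ys x ℕ.< List.length ys
    indexIn-< {z ∷ zs} {x} x∈ with x ≟ z
    ... | yes _ = ℕ.z<s
    indexIn-< (here x≈z) | no x≉z = ⊥-elim (x≉z x≈z)
    indexIn-< (there x∈) | no _   = ℕ.s<s (indexIn-< x∈)

    index : Carrier → ℕ
    index = indexIn elements

    index-cong : ∀ {x y} → x ≈ y → index x ≡ index y
    index-cong = indexIn-cong elements

    index-injective : ∀ {x y} → index x ≡ index y → x ≈ y
    index-injective {x} {y} = indexIn-injective (proj₂ finite x) (proj₂ finite y)

  -- Among the iterates y, f y, f (f y), ... two coincide by the pigeonhole principle. Cancelling f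
  -- from both as often as possible leaves y = f (...), so a preimage lies on the orbit of y itself.
  injective⇒surjective : (f : Carrier → Carrier) → (∀ {x y} → f x ≈ f y → x ≈ y) →
    ∀ y → ∃[ x ] f x ≈ y
  injective⇒surjective f f-injective y = collide (Fin.pigeonhole (ℕ.n<1+n _) slot)
    where
    iterate : ℕ → Carrier
    iterate zero    = y
    iterate (suc n) = f (iterate n)

    cancel : ∀ i k → iterate i ≈ iterate (i ℕ.+ suc k) → f (iterate k) ≈ y
    cancel zero    k eq = sym eq
    cancel (suc i) k eq = cancel i k (f-injective eq)

    slot : Fin (suc (List.length elements)) → Fin (List.length elements)
    slot i = fromℕ< (indexIn-< (proj₂ finite (iterate (toℕ i))))

    collide : (∃[ i ] ∃[ j ] (i Fin.< j × slot i ≡ slot j)) → ∃[ x ] f x ≈ y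
    collide (i , j , i<j , eq) with k , i+1+k≡j ← ℕ.m≤n⇒∃[o]m+o≡n i<j =
      iterate k , cancel (toℕ i) k (trans
        (index-injective (Fin.fromℕ<-injective _ _ _ _ eq))
        (reflexive (≡.cong iterate (≡.trans (≡.sym i+1+k≡j) (≡.sym (ℕ.+-suc (toℕ i) k))))))

  square-injective : ∀ {x y} → x * x ≈ y * y → x ≈ y ⊎ x ≈ - y
  square-injective {x} {y} xx≈yy with (x - y) ≟ 0#
  ... | yes x-y≈0 = inj₁ (x∙y⁻¹≈ε⇒x≈y x y x-y≈0)
  ... | no  x-y≉0 = inj₂ (begin
    x                ≈⟨ solve 2 (λ x y → x := (x :+ y) :- y) (x ∷ y ∷ []) ⟩
    (x + y) - y      ≈⟨ +-congʳ (x*y≈0⇒y≈0 x-y≉0 (begin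
      (x - y) * (x + y)  ≈⟨ solve 2 (λ x y → (x :- y) :* (x :+ y) := x :* x :- y :* y) (x ∷ y ∷ []) ⟩
      x * x - y * y      ≈⟨ x≈y⇒x-y≈0 xx≈yy ⟩
      0#                 ∎)) ⟩
    0# - y           ≈⟨ +-identityˡ _ ⟩
    - y              ∎)

  -- Choose one element out of each pair {x , - x}: sending the chosen x to
  -- x² and the other ones to σ x² is injective, hence surjective.
  square-or-σ*square : ∀ {σ} → IsNonSquare F σ → ∀ t → (∃[ s ] s * s ≈ t) ⊎ (∃[ s ] σ * (s * s) ≈ t)
  square-or-σ*square {σ} nonsquare t = fromPreimage (injective⇒surjective f f-injective t)
    where
    f : Carrier → Carrier
    f x with index x ℕ.<? index (- x)
    ... | yes _ = x * x
    ... | no  _ = σ * (x * x)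

    fromPreimage : (∃[ x ] f x ≈ t) → (∃[ s ] s * s ≈ t) ⊎ (∃[ s ] σ * (s * s) ≈ t)
    fromPreimage (x , fx≈t) with index x ℕ.<? index (- x)
    ... | yes _ = inj₁ (x , fx≈t)
    ... | no  _ = inj₂ (x , fx≈t)

    σ≉0 : ¬ σ ≈ 0#
    σ≉0 σ≈0 = nonsquare 0# (trans (zeroˡ 0#) (sym σ≈0))

    index-neg : ∀ {x y} → x ≈ - y → index x ≡ index (- y) × index (- x) ≡ index y
    index-neg {x} {y} x≈-y = index-cong x≈-y , index-cong (trans (-‿cong x≈-y) (⁻¹-involutive y))
      where open GroupProperties +-group using (⁻¹-involutive)

    -- A chosen x is nonzero, since x and -x have different indices. Then y is nonzero as well, and
    -- σ would be the square of x / y.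
    mixed : ∀ x y → index x ℕ.< index (- x) → ¬ x * x ≈ σ * (y * y)
    mixed x y x<-x xx≈σyy with y ≟ 0#
    ... | yes y≈0 = ℕ.<-irrefl (index-cong (trans x≈0 (sym (trans (-‿cong x≈0) -0#≈0#)))) x<-x
      where
      x≈0 : x ≈ 0#
      x≈0 = x*x≈0⇒x≈0 (trans xx≈σyy (y≈0⇒x*y≈0 (x≈0⇒x*y≈0 y≈0)))
    ... | no y≉0 with i , yi≈1 ← inverse y y≉0 = nonsquare (x * i) (begin
      x * i * (x * i)          ≈⟨ solve 2 (λ x i → x :* i :* (x :* i) := x :* x :* (i :* i)) (x ∷ i ∷ []) ⟩
      x * x * (i * i)          ≈⟨ *-congʳ xx≈σyy ⟩
      σ * (y * y) * (i * i)    ≈⟨ solve 3 (λ σ y i → σ :* (y :* y) :* (i :* i) := σ :* ((y :* i) :* (y :* i))) (σ ∷ y ∷ i ∷ []) ⟩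
      σ * (y * i * (y * i))    ≈⟨ *-congˡ (*-cong yi≈1 yi≈1) ⟩
      σ * (1# * 1#)            ≈⟨ trans (*-congˡ (*-identityˡ 1#)) (*-identityʳ σ) ⟩
      σ                        ∎)

    f-injective : ∀ {x y} → f x ≈ f y → x ≈ y
    f-injective {x} {y} eq with index x ℕ.<? index (- x) | index y ℕ.<? index (- y)
    ... | yes x<-x | no  _    = ⊥-elim (mixed x y x<-x eq)
    ... | no  _    | yes y<-y = ⊥-elim (mixed y x y<-y (sym eq))
    ... | yes x<-x | yes y<-y with square-injective eq
    ... | inj₁ x≈y  = x≈y
    ... | inj₂ x≈-y with e₁ , e₂ ← index-neg x≈-y =
      ⊥-elim (ℕ.<-asym y<-y (≡.subst₂ ℕ._<_ e₁ e₂ x<-x))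
    f-injective {x} {y} eq | no x≮-x | no y≮-y with square-injective (*-cancelˡ σ≉0 eq)
    ... | inj₁ x≈y  = x≈y
    -- With x = -y the two failed inequalities read index x ≤ index y and index y ≤ index x. This
    -- branch is consistent, as 0 is never chosen.
    ... | inj₂ x≈-y with e₁ , e₂ ← index-neg x≈-y = index-injective
      (ℕ.≤-antisym (≡.subst (ℕ._≤ index y) (≡.sym e₁) (ℕ.≮⇒≥ y≮-y))
        (≡.subst (ℕ._≤ index x) e₂ (ℕ.≮⇒≥ x≮-x)))

-- Linear substitutions in cubic forms, and equivalence

module Substitution {c ℓ} (R : CommutativeRing c ℓ) where
  open CommutativeRing R
  open PolyOps R

  -- homSubst over an arbitrary commutative ring, on cubics given as lists
  homSubst′ : Poly → Poly → Poly → Poly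
  homSubst′ (v₀ ∷ v₁ ∷ v₂ ∷ v₃ ∷ []) p q =
    (v₀ ·ₚ (q ^ₚ 3)) +ₚ (v₁ ·ₚ (p *ₚ q ^ₚ 2)) +ₚ (v₂ ·ₚ (p ^ₚ 2 *ₚ q)) +ₚ (v₃ ·ₚ (p ^ₚ 3))
  homSubst′ _ p q = []

  -- This and the next definitions are vocabulary for use over `expressions n`; names different from
  -- the operators avoid clashes with those of the field in scope.
  combine : (a b : Carrier) → Poly → Poly → Poly
  combine a b p q = (a ·ₚ p) +ₚ (b ·ₚ q)

  cubicForm : (v₀ v₁ v₂ v₃ : Carrier) → Poly
  cubicForm v₀ v₁ v₂ v₃ = v₀ ∷ v₁ ∷ v₂ ∷ v₃ ∷ []

  linearForm : (v₀ v₁ : Carrier) → Poly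
  linearForm v₀ v₁ = v₀ ∷ v₁ ∷ []

  scale : Carrier → Poly → Poly
  scale = _·ₚ_

  plus : Poly → Poly → Poly
  plus = _+ₚ_

  multiply : Poly → Poly → Poly
  multiply = _*ₚ_

  multiple : ℕ → Carrier
  multiple n = n ×1

module Equivalence {c ℓ} (F : Field c ℓ) where
  open Field F
  open PolyOps commutativeRing
  open PolyEquality commutativeRing
  open IntegerSolver commutativeRing

  homSubst-cong : ∀ {v₀ v₁ v₂ v₃ w₀ w₁ w₂ w₃} p q →
    (v₀ ∷ v₁ ∷ v₂ ∷ v₃ ∷ []) ≋ (w₀ ∷ w₁ ∷ w₂ ∷ w₃ ∷ []) →
    homSubst F (v₀ ∷ v₁ ∷ v₂ ∷ v₃ ∷ []) p q ≋ homSubst F (w₀ ∷ w₁ ∷ w₂ ∷ w₃ ∷ []) p q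
  homSubst-cong p q (e₀ ∷ e₁ ∷ e₂ ∷ e₃ ∷ []) =
    +ₚ-cong (+ₚ-cong (+ₚ-cong (·ₚ-congʳ (q ^ₚ 3) e₀) (·ₚ-congʳ (p *ₚ q ^ₚ 2) e₁)) (·ₚ-congʳ (p ^ₚ 2 *ₚ q) e₂)) (·ₚ-congʳ (p ^ₚ 3) e₃)

  homSubst-linear : ∀ {g₀ g₁ g₂ g₃ h₀ h₁ h₂ h₃} a b p₀ p₁ q₀ q₁ →
    let p = p₀ ∷ p₁ ∷ [] ; q = q₀ ∷ q₁ ∷ [] in
    (a ·ₚ homSubst F (g₀ ∷ g₁ ∷ g₂ ∷ g₃ ∷ []) p q) +ₚ (b ·ₚ homSubst F (h₀ ∷ h₁ ∷ h₂ ∷ h₃ ∷ []) p q) ≋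
    homSubst F (a * g₀ + b * h₀ ∷ a * g₁ + b * h₁ ∷ a * g₂ + b * h₂ ∷ a * g₃ + b * h₃ ∷ []) p q
  homSubst-linear {g₀} {g₁} {g₂} {g₃} {h₀} {h₁} {h₂} {h₃} a b p₀ p₁ q₀ q₁ =
    solveₚ 14 (λ g₀ g₁ g₂ g₃ h₀ h₁ h₂ h₃ a b p₀ p₁ q₀ q₁ →
        let open Substitution (expressions 14)
            p = linearForm p₀ p₁ ; q = linearForm q₀ q₁ ; g = cubicForm g₀ g₁ g₂ g₃ ; h = cubicForm h₀ h₁ h₂ h₃
        in combine a b (homSubst′ g p q) (homSubst′ h p q) , homSubst′ (combine a b g h) p q)
      (g₀ ∷ g₁ ∷ g₂ ∷ g₃ ∷ h₀ ∷ h₁ ∷ h₂ ∷ h₃ ∷ a ∷ b ∷ p₀ ∷ p₁ ∷ q₀ ∷ q₁ ∷ [])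

  module _ {g₀ g₁ g₂ g₃ h₀ h₁ h₂ h₃ : Carrier} (α β γ δ κ : Carrier) where
    private
      g h : Vec Carrier 4
      g = g₀ ∷ g₁ ∷ g₂ ∷ g₃ ∷ []
      h = h₀ ∷ h₁ ∷ h₂ ∷ h₃ ∷ []
      G H : Poly
      G = Vec.toList g
      H = Vec.toList h
      p q p⁻ q⁻ : Poly
      p = β ∷ α ∷ []
      q = δ ∷ γ ∷ []
      p⁻ = (- β) ∷ δ ∷ []
      q⁻ = α ∷ (- γ) ∷ []
      Δ : Carrier
      Δ = α * δ - β * γ
      κ′ : Carrier
      κ′ = κ * (Δ * (Δ * Δ))

    -- The pair (`p⁻`, `q⁻`) is the adjugate of (`p`, `q`), and is what `act` substitutes for A⁻¹.
    -- The two substitutions compose to multiplying both variables by `Δ`, which a cubic form turns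
    -- into the factor Δ³.
    substitute-back : ∀ {a b n₀ n₁ n₂ n₃} →
      let n = n₀ ∷ n₁ ∷ n₂ ∷ n₃ ∷ [] in
      (a ·ₚ G) +ₚ (b ·ₚ H) ≋ κ ·ₚ homSubst F n p q →
      (a ·ₚ homSubst F g p⁻ q⁻) +ₚ (b ·ₚ homSubst F h p⁻ q⁻) ≋ κ′ ·ₚ Vec.toList n
    substitute-back {a} {b} {n₀} {n₁} {n₂} {n₃} eq = ≋-trans
      (homSubst-linear a b (- β) δ α (- γ))
      (≋-trans (homSubst-cong p⁻ q⁻ eq)
        (solveₚ 9 (λ n₀ n₁ n₂ n₃ κ α β γ δ →
            let open Substitution (expressions 9)
                Δ = α :* δ :- β :* γ ; n = cubicForm n₀ n₁ n₂ n₃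
            in homSubst′ (scale κ (homSubst′ n (linearForm β α) (linearForm δ γ))) (linearForm (:- β) δ) (linearForm α (:- γ)) ,
               scale (κ :* (Δ :* (Δ :* Δ))) n)
          (n₀ ∷ n₁ ∷ n₂ ∷ n₃ ∷ κ ∷ α ∷ β ∷ γ ∷ δ ∷ [])))

    -- The two identities say that B ∘ R = (n / d′) ∘ A, where A is x ↦ (α x + β) / (γ x + δ) and B
    -- has coefficients a, b, c, d. The common factor `κ` lets B be given by minors without
    -- dividing; it cancels in the cross-multiplied equality.
    equivalent : ∀ {a b c d n₀ n₁ n₂ n₃ d₀ d₁ d₂ d₃} →
      let n = n₀ ∷ n₁ ∷ n₂ ∷ n₃ ∷ [] ; d′ = d₀ ∷ d₁ ∷ d₂ ∷ d₃ ∷ [] in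
      ¬ Δ ≈ 0# → ¬ a * d - b * c ≈ 0# →
      (a ·ₚ G) +ₚ (b ·ₚ H) ≋ κ ·ₚ homSubst F n p q →
      (c ·ₚ G) +ₚ (d ·ₚ H) ≋ κ ·ₚ homSubst F d′ p q →
      EquivalentOver F (g / h) (n / d′)
    equivalent {a} {b} {c} {d} {n₀} {n₁} {n₂} {n₃} {d₀} {d₁} {d₂} {d₃} Δ≉0 det≉0 eqN eqD =
      mob a b c d det≉0 , mob α β γ δ Δ≉0 , ≋⇒≈ₚ (≋-trans
        (*ₚ-cong (substitute-back eqN) (≋-refl {d₀ ∷ d₁ ∷ d₂ ∷ d₃ ∷ []}))
        (≋-trans
          (solveₚ 9 (λ k n₀ n₁ n₂ n₃ d₀ d₁ d₂ d₃ →
              let open Substitution (expressions 9) ; n = cubicForm n₀ n₁ n₂ n₃ ; d = cubicForm d₀ d₁ d₂ d₃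
              in multiply (scale k n) d , multiply n (scale k d))
            (κ′ ∷ n₀ ∷ n₁ ∷ n₂ ∷ n₃ ∷ d₀ ∷ d₁ ∷ d₂ ∷ d₃ ∷ []))
          (*ₚ-cong (≋-refl {n₀ ∷ n₁ ∷ n₂ ∷ n₃ ∷ []}) (≋-sym (substitute-back eqD)))))

-- Rational ramification points of index three

module NormalForms {c ℓ} (F : Field c ℓ) (finite : IsFinite F) (char≥5 : CharAtLeast5 F)
  (σ : Field.Carrier F) (nonsquare : IsNonSquare F σ) where
  open Field F
  open PolyOps commutativeRing
  open PolyEquality commutativeRing
  open FieldProperties F
  open IntegerSolver commutativeRing
  open Equivalence F
  open FiniteFieldSquares F finite
  open import Relation.Binary.Reasoning.Setoid setoid

  2≉0 : ¬ 2 ×1 ≈ 0#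
  2≉0 = char≥5 2 (s≤s z≤n) (s≤s (s≤s z≤n))

  3≉0 : ¬ 3 ×1 ≈ 0#
  3≉0 = char≥5 3 (s≤s z≤n) (s≤s (s≤s (s≤s z≤n)))

  absorb : ∀ {x y d} c → x ≈ y + c * d → d ≈ 0# → x ≈ y
  absorb c eq d≈0 = trans eq (trans (+-congˡ (y≈0⇒x*y≈0 d≈0)) (+-identityʳ _))

  OneOfNormalForms : RatExpr F → Set _
  OneOfNormalForms R = EquivalentOver F R (nf₁ F) ⊎ EquivalentOver F R (nf₂ F σ)
    ⊎ EquivalentOver F R (nf₃ F) ⊎ EquivalentOver F R (nf₄ F σ)

  -- The forms G and H are expressed in the basis m³, m²l, ml², l³ of binary
  -- cubics, where m and l are linear and l vanishes at the point of interest.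
  module _ {g₀ g₁ g₂ g₃ h₀ h₁ h₂ h₃ v₀ v₁ v₂ v₃ w₀ w₁ w₂ w₃ m₀ m₁ l₀ l₁ : Carrier}
    (G≋ : (g₀ ∷ g₁ ∷ g₂ ∷ g₃ ∷ []) ≋ homSubst F (v₀ ∷ v₁ ∷ v₂ ∷ v₃ ∷ []) (m₀ ∷ m₁ ∷ []) (l₀ ∷ l₁ ∷ []))
    (H≋ : (h₀ ∷ h₁ ∷ h₂ ∷ h₃ ∷ []) ≋ homSubst F (w₀ ∷ w₁ ∷ w₂ ∷ w₃ ∷ []) (m₀ ∷ m₁ ∷ []) (l₀ ∷ l₁ ∷ []))
    (independent : ¬ m₁ * l₀ - m₀ * l₁ ≈ 0#)
    (e₂≈0 : w₃ * v₂ - v₃ * w₂ ≈ 0#)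
    (e₁≈0 : w₃ * v₁ - v₃ * w₁ ≈ 0#)
    (κ≉0 : ¬ w₃ * v₀ - v₃ * w₀ ≈ 0#)
    where
    private
      R : RatExpr F
      R = (g₀ ∷ g₁ ∷ g₂ ∷ g₃ ∷ []) / (h₀ ∷ h₁ ∷ h₂ ∷ h₃ ∷ [])

      κ : Carrier
      κ = w₃ * v₀ - v₃ * w₀

    module _ (x y : Carrier) (c₃≈1 : x * v₃ + y * w₃ ≈ 1#) (third : Carrier) (3*third≈1 : 3 ×1 * third ≈ 1#) where
      private
        c₀ c₁ c₂ b k k′ : Carrier
        c₀ = x * v₀ + y * w₀
        c₁ = x * v₁ + y * w₁
        c₂ = x * v₂ + y * w₂
        b  = third * c₂
        k  = c₁ - 3 ×1 * (b * b)
        k′ = c₀ - b * b * b - k * b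

        3b≈c₂ : 3 ×1 * b ≈ c₂
        3b≈c₂ = trans (sym (*-assoc _ _ _)) (trans (*-congʳ 3*third≈1) (*-identityˡ _))

      module _ (ε s : Carrier) (s≉0 : ¬ s ≈ 0#) (k≈εss : k ≈ ε * (s * s)) where
        private
          A B C D α β γ δ s³ : Carrier
          s³ = s * (s * s)
          A = κ * x - k′ * w₃
          B = κ * y + k′ * v₃
          -- The factor s³ turns w₃ G - v₃ H = κ l³ into κ (s l)³, so that both components are κ
          -- times a form in n = m + b l and s l.
          C = s³ * w₃
          D = - (s³ * v₃)
          α = m₁ + b * l₁
          β = m₀ + b * l₀
          γ = s * l₁
          δ = s * l₀

          -- x G + y H = n³ + k n l² + k′ l³ for n = m + b l, and the term k′ l³
          -- is removed by a multiple of w₃ G - v₃ H = κ l³.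
          numerator : (A ·ₚ (g₀ ∷ g₁ ∷ g₂ ∷ g₃ ∷ [])) +ₚ (B ·ₚ (h₀ ∷ h₁ ∷ h₂ ∷ h₃ ∷ [])) ≋
            κ ·ₚ homSubst F (0# ∷ ε ∷ 0# ∷ 1# ∷ []) (β ∷ α ∷ []) (δ ∷ γ ∷ [])
          numerator = ≋-trans (+ₚ-cong (·ₚ-cong refl G≋) (·ₚ-cong refl H≋))
            (≋-trans (homSubst-linear A B m₀ m₁ l₀ l₁)
            (≋-trans (homSubst-cong (m₀ ∷ m₁ ∷ []) (l₀ ∷ l₁ ∷ []) (E₀ ∷ E₁ ∷ E₂ ∷ E₃ ∷ []))
            (solveₚ 8 (λ κ ε s b m₀ m₁ l₀ l₁ →
                let open Substitution (expressions 8) ; 𝟎 = con (+ 0) ; 𝟏 = con (+ 1) ; 𝟑 = multiple 3 in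
                homSubst′ (cubicForm (κ :* (b :* b :* b :+ ε :* (s :* s) :* b)) (κ :* (𝟑 :* (b :* b) :+ ε :* (s :* s)))
                    (κ :* (𝟑 :* b)) (κ :* 𝟏)) (linearForm m₀ m₁) (linearForm l₀ l₁) ,
                scale κ (homSubst′ (cubicForm 𝟎 ε 𝟎 𝟏) (linearForm (m₀ :+ b :* l₀) (m₁ :+ b :* l₁)) (linearForm (s :* l₀) (s :* l₁))))
              (κ ∷ ε ∷ s ∷ b ∷ m₀ ∷ m₁ ∷ l₀ ∷ l₁ ∷ []))))
            where
            rearrange : ∀ v w → A * v + B * w ≈ κ * (x * v + y * w) + (- k′) * (w₃ * v - v₃ * w)
            rearrange v w = solve 8 (λ κ x y k′ v₃ w₃ v w →
                (κ :* x :- k′ :* w₃) :* v :+ (κ :* y :+ k′ :* v₃) :* w :=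
                κ :* (x :* v :+ y :* w) :+ (:- k′) :* (w₃ :* v :- v₃ :* w))
              (κ ∷ x ∷ y ∷ k′ ∷ v₃ ∷ w₃ ∷ v ∷ w ∷ [])

            E₀ : A * v₀ + B * w₀ ≈ κ * (b * b * b + ε * (s * s) * b)
            E₀ = begin
              A * v₀ + B * w₀             ≈⟨ rearrange v₀ w₀ ⟩
              κ * c₀ + (- k′) * κ         ≈⟨ solve 4 (λ κ c₀ b k →
                  κ :* c₀ :+ (:- (c₀ :- b :* b :* b :- k :* b)) :* κ := κ :* (b :* b :* b :+ k :* b))
                (κ ∷ c₀ ∷ b ∷ k ∷ []) ⟩
              κ * (b * b * b + k * b)     ≈⟨ *-congˡ (+-congˡ (*-congʳ k≈εss)) ⟩
              κ * (b * b * b + ε * (s * s) * b) ∎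

            E₁ : A * v₁ + B * w₁ ≈ κ * (3 ×1 * (b * b) + ε * (s * s))
            E₁ = begin
              A * v₁ + B * w₁                ≈⟨ absorb (- k′) (rearrange v₁ w₁) e₁≈0 ⟩
              κ * c₁                         ≈⟨ solve 3 (λ κ c₁ d → κ :* c₁ := κ :* (d :+ (c₁ :- d))) (κ ∷ c₁ ∷ 3 ×1 * (b * b) ∷ []) ⟩
              κ * (3 ×1 * (b * b) + k)       ≈⟨ *-congˡ (+-congˡ k≈εss) ⟩
              κ * (3 ×1 * (b * b) + ε * (s * s)) ∎

            E₂ : A * v₂ + B * w₂ ≈ κ * (3 ×1 * b)
            E₂ = trans (absorb (- k′) (rearrange v₂ w₂) e₂≈0) (*-congˡ (sym 3b≈c₂))

            E₃ : A * v₃ + B * w₃ ≈ κ * 1#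
            E₃ = trans (absorb (- k′) (rearrange v₃ w₃) (x≈y⇒x-y≈0 (*-comm w₃ v₃))) (*-congˡ c₃≈1)

          denominator : (C ·ₚ (g₀ ∷ g₁ ∷ g₂ ∷ g₃ ∷ [])) +ₚ (D ·ₚ (h₀ ∷ h₁ ∷ h₂ ∷ h₃ ∷ [])) ≋
            κ ·ₚ homSubst F (1# ∷ 0# ∷ 0# ∷ 0# ∷ []) (β ∷ α ∷ []) (δ ∷ γ ∷ [])
          denominator = ≋-trans (+ₚ-cong (·ₚ-cong refl G≋) (·ₚ-cong refl H≋))
            (≋-trans (homSubst-linear C D m₀ m₁ l₀ l₁)
            (≋-trans (homSubst-cong (m₀ ∷ m₁ ∷ []) (l₀ ∷ l₁ ∷ [])
              (rearrange v₀ w₀ ∷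
               trans (rearrange v₁ w₁) (y≈0⇒x*y≈0 e₁≈0) ∷
               trans (rearrange v₂ w₂) (y≈0⇒x*y≈0 e₂≈0) ∷
               trans (rearrange v₃ w₃) (y≈0⇒x*y≈0 (x≈y⇒x-y≈0 (*-comm w₃ v₃))) ∷ []))
            (solveₚ 7 (λ κ s b m₀ m₁ l₀ l₁ →
                let open Substitution (expressions 7) ; 𝟎 = con (+ 0) ; 𝟏 = con (+ 1) in
                homSubst′ (cubicForm (s :* (s :* s) :* κ) 𝟎 𝟎 𝟎) (linearForm m₀ m₁) (linearForm l₀ l₁) ,
                scale κ (homSubst′ (cubicForm 𝟏 𝟎 𝟎 𝟎) (linearForm (m₀ :+ b :* l₀) (m₁ :+ b :* l₁)) (linearForm (s :* l₀) (s :* l₁))))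
              (κ ∷ s ∷ b ∷ m₀ ∷ m₁ ∷ l₀ ∷ l₁ ∷ []))))
            where
            rearrange : ∀ v w → C * v + D * w ≈ s³ * (w₃ * v - v₃ * w)
            rearrange v w = solve 5 (λ s³ v₃ w₃ v w →
                s³ :* w₃ :* v :+ (:- (s³ :* v₃)) :* w := s³ :* (w₃ :* v :- v₃ :* w))
              (s³ ∷ v₃ ∷ w₃ ∷ v ∷ w ∷ [])

          s³≉0 : ¬ s³ ≈ 0#
          s³≉0 = x*y≉0 s≉0 (x*y≉0 s≉0 s≉0)

        -- The values 0, -3 and -3 σ of `ε` give the three polynomial normal forms. The substitution
        -- is A = n / (s l), and the determinant of B is -s³ κ because x v₃ + y w₃ = 1.
        triplePoint-depressed : EquivalentOver F R ((0# ∷ ε ∷ 0# ∷ 1# ∷ []) / (1# ∷ 0# ∷ 0# ∷ 0# ∷ []))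
        triplePoint-depressed = equivalent α β γ δ κ
          (λ Δ≈0 → x*y≉0 s≉0 independent (trans
            (solve 6 (λ s b m₀ m₁ l₀ l₁ → s :* (m₁ :* l₀ :- m₀ :* l₁) :=
                (m₁ :+ b :* l₁) :* (s :* l₀) :- (m₀ :+ b :* l₀) :* (s :* l₁))
              (s ∷ b ∷ m₀ ∷ m₁ ∷ l₀ ∷ l₁ ∷ [])) Δ≈0))
          (λ det≈0 → x*y≉0 s³≉0 κ≉0 (begin
            s³ * κ                        ≈⟨ *-identityʳ _ ⟨
            s³ * κ * 1#                   ≈⟨ *-congˡ c₃≈1 ⟨
            s³ * κ * (x * v₃ + y * w₃)    ≈⟨ solve 7 (λ s³ κ x y k′ v₃ w₃ →
                s³ :* κ :* (x :* v₃ :+ y :* w₃) :=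
                :- ((κ :* x :- k′ :* w₃) :* (:- (s³ :* v₃)) :- (κ :* y :+ k′ :* v₃) :* (s³ :* w₃)))
              (s³ ∷ κ ∷ x ∷ y ∷ k′ ∷ v₃ ∷ w₃ ∷ []) ⟩
            - (A * D - B * C)             ≈⟨ trans (-‿cong det≈0) -0#≈0# ⟩
            0#                            ∎))
          numerator denominator

      triplePoint-normalForm : OneOfNormalForms R
      triplePoint-normalForm with k ≟ 0#
      ... | yes k≈0 = inj₁ (triplePoint-depressed 0# 1# 1≉0 (trans k≈0 (sym (zeroˡ _))))
      ... | no  k≉0 = split (square-or-σ*square nonsquare t)
        where
        -- Chosen so that k = -3 t: then t = s² gives ε = -3, and t = σ s² gives ε = -3 σ.
        t : Carrier
        t = - (third * k)

        -3t≈k : - (3 ×1) * t ≈ k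
        -3t≈k = begin
          - (3 ×1) * t          ≈⟨ solve 3 (λ 𝟑 i k → (:- 𝟑) :* (:- (i :* k)) := 𝟑 :* i :* k) (3 ×1 ∷ third ∷ k ∷ []) ⟩
          3 ×1 * third * k      ≈⟨ trans (*-congʳ 3*third≈1) (*-identityˡ k) ⟩
          k                     ∎

        t≉0 : ¬ t ≈ 0#
        t≉0 t≈0 = k≉0 (trans (sym -3t≈k) (y≈0⇒x*y≈0 t≈0))

        split : (∃[ s ] s * s ≈ t) ⊎ (∃[ s ] σ * (s * s) ≈ t) → OneOfNormalForms R
        split (inj₁ (s , ss≈t)) = inj₂ (inj₂ (inj₁ (triplePoint-depressed (- three F) s
          (λ s≈0 → t≉0 (trans (sym ss≈t) (x≈0⇒x*y≈0 s≈0)))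
          (trans (sym -3t≈k) (*-congˡ (sym ss≈t))))))
        split (inj₂ (s , σss≈t)) = inj₂ (inj₂ (inj₂ (triplePoint-depressed (- (three F * σ)) s
          (λ s≈0 → t≉0 (trans (sym σss≈t) (y≈0⇒x*y≈0 (x≈0⇒x*y≈0 s≈0))))
          (trans (sym -3t≈k) (trans (*-congˡ (sym σss≈t))
            (solve 3 (λ 𝟑 σ ss → (:- 𝟑) :* (σ :* ss) := (:- (𝟑 :* σ)) :* ss) (3 ×1 ∷ σ ∷ s * s ∷ [])))))))

    -- The image of the triple point is [v₃ : w₃]. Any x G + y H whose m³-coefficient is 1 will do,
    -- so it suffices to invert whichever of v₃, w₃ is nonzero.
    triplePoint : ¬ (v₃ ≈ 0# × w₃ ≈ 0#) → OneOfNormalForms R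
    triplePoint v₃w₃≉0 with inverse (3 ×1) 3≉0 | v₃ ≟ 0#
    ... | third , 3*third≈1 | no v₃≉0 with i , v₃i≈1 ← inverse v₃ v₃≉0 =
      triplePoint-normalForm i 0#
        (trans (+-cong (trans (*-comm i v₃) v₃i≈1) (zeroˡ w₃)) (+-identityʳ 1#)) third 3*third≈1
    ... | third , 3*third≈1 | yes v₃≈0 with i , w₃i≈1 ← inverse w₃ (λ w₃≈0 → v₃w₃≉0 (v₃≈0 , w₃≈0)) =
      triplePoint-normalForm 0# i
        (trans (+-cong (zeroˡ v₃) (trans (*-comm i w₃) w₃i≈1)) (+-identityˡ 1#)) third 3*third≈1

-- The pencil spanned by the numerator and the denominator

module Pencil {c ℓ} (R : CommutativeRing c ℓ) (g₀ g₁ g₂ g₃ h₀ h₁ h₂ h₃ : CommutativeRing.Carrier R) where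
  open CommutativeRing R
  open PolyOps R

  p₀₁ p₀₂ p₀₃ p₁₂ p₁₃ p₂₃ : Carrier
  p₀₁ = g₀ * h₁ - g₁ * h₀
  p₀₂ = g₀ * h₂ - g₂ * h₀
  p₀₃ = g₀ * h₃ - g₃ * h₀
  p₁₂ = g₁ * h₂ - g₂ * h₁
  p₁₃ = g₁ * h₃ - g₃ * h₁
  p₂₃ = g₂ * h₃ - g₃ * h₂

  G H G₁ H₁ G₂ H₂ : Poly
  G  = g₀ ∷ g₁ ∷ g₂ ∷ g₃ ∷ []
  H  = h₀ ∷ h₁ ∷ h₂ ∷ h₃ ∷ []
  G₁ = g₁ ∷ 2 ×1 * g₂ ∷ 3 ×1 * g₃ ∷ []
  H₁ = h₁ ∷ 2 ×1 * h₂ ∷ 3 ×1 * h₃ ∷ []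
  G₂ = g₂ ∷ 3 ×1 * g₃ ∷ []
  H₂ = h₂ ∷ 3 ×1 * h₃ ∷ []

  -- With Gᵢ = G⁽ⁱ⁾ / i!, these are G H₁ - G₁ H, G H₂ - G₂ H and G₁ H₂ - G₂ H₁.
  W₀₁ W₀₂ W₁₂ : Poly
  W₀₁ = p₀₁ ∷ 2 ×1 * p₀₂ ∷ 3 ×1 * p₀₃ + p₁₂ ∷ 2 ×1 * p₁₃ ∷ p₂₃ ∷ []
  W₀₂ = p₀₂ ∷ 3 ×1 * p₀₃ + p₁₂ ∷ 3 ×1 * p₁₃ ∷ 2 ×1 * p₂₃ ∷ []
  W₁₂ = p₁₂ ∷ 3 ×1 * p₁₃ ∷ 3 ×1 * p₂₃ ∷ []

  -- X² W₁₂ - 3 X W₀₂ + 3 W₀₁, in which the coefficients of X³ and X⁴ cancel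
  V : Poly
  V = 3 ×1 * p₀₁ ∷ 3 ×1 * p₀₂ ∷ p₁₂ ∷ []

  -- p₁₂ W₁₂ - 3 p₂₃ V
  U : Poly
  U = p₁₂ * p₁₂ - 3 ×1 * p₂₃ * (3 ×1 * p₀₁) ∷ 3 ×1 * (p₁₂ * p₁₃ - p₂₃ * (3 ×1 * p₀₂)) ∷ []

module PencilIdentities {c ℓ} (R : CommutativeRing c ℓ) (g₀ g₁ g₂ g₃ h₀ h₁ h₂ h₃ : CommutativeRing.Carrier R) where
  open CommutativeRing R
  open PolyOps R
  open PolyEquality R
  open PolyEvaluation R
  open IntegerSolver R
  open Pencil R g₀ g₁ g₂ g₃ h₀ h₁ h₂ h₃

  private
    env : Vec Carrier 8
    env = g₀ ∷ g₁ ∷ g₂ ∷ g₃ ∷ h₀ ∷ h₁ ∷ h₂ ∷ h₃ ∷ []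

  ≋-trim : ∀ k {p} q → p ≋ q ++ replicate k 0# → p ≈ₚ q
  ≋-trim zero    []      []       = _
  ≋-trim (suc k) []      (e ∷ es) = e , ≋-trim k [] es
  ≋-trim k       (b ∷ q) (e ∷ es) = e , ≋-trim k q es

  plücker : p₀₁ * p₂₃ - p₀₂ * p₁₃ + p₀₃ * p₁₂ ≈ 0#
  plücker = solve 8 (λ g₀ g₁ g₂ g₃ h₀ h₁ h₂ h₃ →
      let module P = Pencil (expressions 8) g₀ g₁ g₂ g₃ h₀ h₁ h₂ h₃ in
      P.p₀₁ :* P.p₂₃ :- P.p₀₂ :* P.p₁₃ :+ P.p₀₃ :* P.p₁₂ := con (+ 0)) env

  deriv-W₀₁ : deriv W₀₁ ≈ₚ 2 ×1 ·ₚ W₀₂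
  deriv-W₀₁ = ≋-trim 1 (2 ×1 ·ₚ W₀₂) (solveₚ 8 (λ g₀ g₁ g₂ g₃ h₀ h₁ h₂ h₃ →
      let module P = Pencil (expressions 8) g₀ g₁ g₂ g₃ h₀ h₁ h₂ h₃
          open Substitution (expressions 8) in
      PolyEvaluation.deriv (expressions 8) P.W₀₁ , scale (multiple 2) P.W₀₂ ++ [ con (+ 0) ]) env)

  W₀₁-expand : (G *ₚ deriv H) +ₚ ((- 1#) ·ₚ (deriv G *ₚ H)) ≈ₚ W₀₁
  W₀₁-expand = ≋-trim 2 W₀₁ (solveₚ 8 (λ g₀ g₁ g₂ g₃ h₀ h₁ h₂ h₃ →
      let module P = Pencil (expressions 8) g₀ g₁ g₂ g₃ h₀ h₁ h₂ h₃
          open Substitution (expressions 8) ; D = PolyEvaluation.deriv (expressions 8) in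
      plus (multiply P.G (D P.H)) (scale (:- con (+ 1)) (multiply (D P.G) P.H)) ,
      P.W₀₁ ++ replicate 2 (con (+ 0))) env)

  -- Expansion of a vanishing 3 × 3 determinant: its columns are (G, G₁, G₂), the same again, and
  -- (H, H₁, H₂). The next identity repeats the other column.
  G*W₁₂ : G *ₚ W₁₂ ≋ (G₁ *ₚ W₀₂) +ₚ ((- 1#) ·ₚ (G₂ *ₚ W₀₁))
  G*W₁₂ = solveₚ 8 (λ g₀ g₁ g₂ g₃ h₀ h₁ h₂ h₃ →
      let module P = Pencil (expressions 8) g₀ g₁ g₂ g₃ h₀ h₁ h₂ h₃
          open Substitution (expressions 8) in
      multiply P.G P.W₁₂ , plus (multiply P.G₁ P.W₀₂) (scale (:- con (+ 1)) (multiply P.G₂ P.W₀₁))) env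

  H*W₁₂ : H *ₚ W₁₂ ≋ (H₁ *ₚ W₀₂) +ₚ ((- 1#) ·ₚ (H₂ *ₚ W₀₁))
  H*W₁₂ = solveₚ 8 (λ g₀ g₁ g₂ g₃ h₀ h₁ h₂ h₃ →
      let module P = Pencil (expressions 8) g₀ g₁ g₂ g₃ h₀ h₁ h₂ h₃
          open Substitution (expressions 8) in
      multiply P.H P.W₁₂ , plus (multiply P.H₁ P.W₀₂) (scale (:- con (+ 1)) (multiply P.H₂ P.W₀₁))) env

  V-expand : (3 ×1 ·ₚ W₀₁) +ₚ (0# ∷ (- (3 ×1)) ·ₚ W₀₂) +ₚ (0# ∷ 0# ∷ W₁₂) ≈ₚ V
  V-expand = ≋-trim 2 V (solveₚ 8 (λ g₀ g₁ g₂ g₃ h₀ h₁ h₂ h₃ →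
      let module P = Pencil (expressions 8) g₀ g₁ g₂ g₃ h₀ h₁ h₂ h₃
          open Substitution (expressions 8) ; 𝟎 = con (+ 0) in
      plus (plus (scale (multiple 3) P.W₀₁) (𝟎 ∷ scale (:- multiple 3) P.W₀₂)) (𝟎 ∷ 𝟎 ∷ P.W₁₂) ,
      P.V ++ replicate 2 𝟎) env)

  eliminate-X³ : (h₃ ·ₚ G) +ₚ ((- g₃) ·ₚ H) ≈ₚ (p₀₃ ∷ p₁₃ ∷ p₂₃ ∷ [])
  eliminate-X³ = ≋-trim 1 (p₀₃ ∷ p₁₃ ∷ p₂₃ ∷ []) (solveₚ 8 (λ g₀ g₁ g₂ g₃ h₀ h₁ h₂ h₃ →
      let module P = Pencil (expressions 8) g₀ g₁ g₂ g₃ h₀ h₁ h₂ h₃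
          open Substitution (expressions 8) in
      combine h₃ (:- g₃) P.G P.H , (P.p₀₃ ∷ P.p₁₃ ∷ P.p₂₃ ∷ con (+ 0) ∷ [])) env)

  U-expand : (p₁₂ ·ₚ W₁₂) +ₚ ((- (3 ×1 * p₂₃)) ·ₚ V) ≈ₚ U
  U-expand = ≋-trim 1 U (solveₚ 8 (λ g₀ g₁ g₂ g₃ h₀ h₁ h₂ h₃ →
      let module P = Pencil (expressions 8) g₀ g₁ g₂ g₃ h₀ h₁ h₂ h₃
          open Substitution (expressions 8) in
      combine P.p₁₂ (:- (multiple 3 :* P.p₂₃)) P.W₁₂ P.V , P.U ++ [ con (+ 0) ]) env)

  module _ (y : Carrier) where
    private
      g̃₀ g̃₁ g̃₂ h̃₀ h̃₁ h̃₂ : Carrier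
      g̃₀ = eval G y
      g̃₁ = eval G₁ y
      g̃₂ = eval G₂ y
      h̃₀ = eval H y
      h̃₁ = eval H₁ y
      h̃₂ = eval H₂ y

    eval-W₀₁ : eval W₀₁ y ≈ - (h̃₀ * g̃₁ - g̃₀ * h̃₁)
    eval-W₀₁ = solve 9 (λ g₀ g₁ g₂ g₃ h₀ h₁ h₂ h₃ y →
        let module P = Pencil (expressions 9) g₀ g₁ g₂ g₃ h₀ h₁ h₂ h₃
            ev = λ p → PolyOps.eval (expressions 9) p y in
        ev P.W₀₁ := :- (ev P.H :* ev P.G₁ :- ev P.G :* ev P.H₁))
      (g₀ ∷ g₁ ∷ g₂ ∷ g₃ ∷ h₀ ∷ h₁ ∷ h₂ ∷ h₃ ∷ y ∷ [])

    eval-W₀₂ : eval W₀₂ y ≈ - (h̃₀ * g̃₂ - g̃₀ * h̃₂)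
    eval-W₀₂ = solve 9 (λ g₀ g₁ g₂ g₃ h₀ h₁ h₂ h₃ y →
        let module P = Pencil (expressions 9) g₀ g₁ g₂ g₃ h₀ h₁ h₂ h₃
            ev = λ p → PolyOps.eval (expressions 9) p y in
        ev P.W₀₂ := :- (ev P.H :* ev P.G₂ :- ev P.G :* ev P.H₂))
      (g₀ ∷ g₁ ∷ g₂ ∷ g₃ ∷ h₀ ∷ h₁ ∷ h₂ ∷ h₃ ∷ y ∷ [])

-- Expansions and divisions of cubics

module Taylor {c ℓ} (F : Field c ℓ) where
  open Field F
  open PolyOps commutativeRing
  open PolyEquality commutativeRing
  open IntegerSolver commutativeRing

  -- For m = 1 and l = X - y the coordinates of a cubic are its divided derivatives at y. The
  -- hypotheses on the coordinates in `triplePoint` thereby become the vanishing of W₀₁ and W₀₂ at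
  -- y.
  taylor : ∀ g₀ g₁ g₂ g₃ y →
    let open Pencil commutativeRing g₀ g₁ g₂ g₃ g₀ g₁ g₂ g₃ in
    G ≋ homSubst F (g₃ ∷ eval G₂ y ∷ eval G₁ y ∷ eval G y ∷ []) (1# ∷ 0# ∷ []) (- y ∷ 1# ∷ [])
  taylor g₀ g₁ g₂ g₃ y = solveₚ 5 (λ g₀ g₁ g₂ g₃ y →
      let open Pencil (expressions 5) g₀ g₁ g₂ g₃ g₀ g₁ g₂ g₃
          open Substitution (expressions 5)
          ev = λ p → PolyOps.eval (expressions 5) p y in
      G , homSubst′ (cubicForm g₃ (ev G₂) (ev G₁) (ev G)) (linearForm (con (+ 1)) (con (+ 0))) (linearForm (:- y) (con (+ 1))))
    (g₀ ∷ g₁ ∷ g₂ ∷ g₃ ∷ y ∷ [])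

  taylor-∞ : ∀ g₀ g₁ g₂ g₃ →
    (g₀ ∷ g₁ ∷ g₂ ∷ g₃ ∷ []) ≋ homSubst F (g₀ ∷ g₁ ∷ g₂ ∷ g₃ ∷ []) (0# ∷ 1# ∷ []) (1# ∷ 0# ∷ [])
  taylor-∞ g₀ g₁ g₂ g₃ = solveₚ 4 (λ g₀ g₁ g₂ g₃ →
      let open Substitution (expressions 4) ; g = cubicForm g₀ g₁ g₂ g₃ in
      g , homSubst′ g (linearForm (con (+ 0)) (con (+ 1))) (linearForm (con (+ 1)) (con (+ 0))))
    (g₀ ∷ g₁ ∷ g₂ ∷ g₃ ∷ [])

  linear-factor : ∀ g₀ g₁ g₂ g₃ y → let G = g₀ ∷ g₁ ∷ g₂ ∷ g₃ ∷ [] in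
    (- y ∷ 1# ∷ []) *ₚ (g₁ + y * (g₂ + y * g₃) ∷ g₂ + y * g₃ ∷ g₃ ∷ []) ≋
    (g₀ + - 1# * eval G y ∷ g₁ ∷ g₂ ∷ g₃ ∷ [])
  linear-factor g₀ g₁ g₂ g₃ y = solveₚ 5 (λ g₀ g₁ g₂ g₃ y →
      let open Substitution (expressions 5) in
      multiply (linearForm (:- y) (con (+ 1))) (g₁ :+ y :* (g₂ :+ y :* g₃) ∷ g₂ :+ y :* g₃ ∷ g₃ ∷ []) ,
      cubicForm (g₀ :+ :- con (+ 1) :* PolyOps.eval (expressions 5) (cubicForm g₀ g₁ g₂ g₃) y) g₁ g₂ g₃)
    (g₀ ∷ g₁ ∷ g₂ ∷ g₃ ∷ y ∷ [])

  quadratic-division : ∀ g₀ g₁ g₂ g₃ s t →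
    ((t ∷ s ∷ 1# ∷ []) *ₚ (g₂ - s * g₃ ∷ g₃ ∷ [])) +ₚ
      (g₀ - t * (g₂ - s * g₃) ∷ g₁ - t * g₃ - s * (g₂ - s * g₃) ∷ []) ≋
    (g₀ ∷ g₁ ∷ g₂ ∷ g₃ ∷ [])
  quadratic-division g₀ g₁ g₂ g₃ s t = solveₚ 6 (λ g₀ g₁ g₂ g₃ s t →
      let open Substitution (expressions 6) in
      plus (multiply (t ∷ s ∷ con (+ 1) ∷ []) (linearForm (g₂ :- s :* g₃) g₃))
        (linearForm (g₀ :- t :* (g₂ :- s :* g₃)) (g₁ :- t :* g₃ :- s :* (g₂ :- s :* g₃))) ,
      cubicForm g₀ g₁ g₂ g₃)
    (g₀ ∷ g₁ ∷ g₂ ∷ g₃ ∷ s ∷ t ∷ [])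

-- Conjugate ramification points of index three

module ConjugatePoints {c ℓ} (F : Field c ℓ) (finite : IsFinite F) (char≥5 : CharAtLeast5 F)
  (σ : Field.Carrier F) (nonsquare : IsNonSquare F σ) (g₀ g₁ g₂ g₃ h₀ h₁ h₂ h₃ : Field.Carrier F) where
  open Field F
  open PolyOps commutativeRing
  open PolyEquality commutativeRing
  open FieldProperties F
  open IntegerSolver commutativeRing
  open Equivalence F
  open NormalForms F finite char≥5 σ nonsquare
  open Pencil commutativeRing g₀ g₁ g₂ g₃ h₀ h₁ h₂ h₃
  open import Relation.Binary.Reasoning.Setoid setoid

  -- (X + u Y ± √σ r Y)³ = N ± √σ D, where N and D are the numerator and the
  -- denominator of nf₂ σ evaluated at (X + u Y , r Y).
  module _ (u r : Carrier) (p₂₃≉0 : ¬ p₂₃ ≈ 0#) (r≉0 : ¬ r ≈ 0#)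
    (p₁₃≈ : p₁₃ - 2 ×1 * u * p₂₃ ≈ 0#)
    (p₁₂≈ : p₁₂ - 3 ×1 * (u * u - σ * (r * r)) * p₂₃ ≈ 0#)
    (p₀₂≈ : p₀₂ - 2 ×1 * u * (u * u - σ * (r * r)) * p₂₃ ≈ 0#)
    (p₀₃≈ : 3 ×1 * p₀₃ - (3 ×1 * (u * u) + σ * (r * r)) * p₂₃ ≈ 0#)
    where
    private
      a b c′ d : Carrier
      -- Cramer's rule on the coefficients of X³ and X²: these are 1 and 3 u in the target
      -- numerator, 0 and 3 r in the target denominator, all times p₂₃. The remaining coefficients
      -- are then forced by the four relations.
      a  = 3 ×1 * u * h₃ - h₂
      b  = g₂ - 3 ×1 * u * g₃
      c′ = 3 ×1 * r * h₃
      d  = - (3 ×1 * r * g₃)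

      env : Vec Carrier 11
      env = g₀ ∷ g₁ ∷ g₂ ∷ g₃ ∷ h₀ ∷ h₁ ∷ h₂ ∷ h₃ ∷ u ∷ r ∷ σ ∷ []

      numerator : (a ·ₚ G) +ₚ (b ·ₚ H) ≋
        p₂₃ ·ₚ homSubst F (0# ∷ 3 ×1 * σ ∷ 0# ∷ 1# ∷ []) (u ∷ 1# ∷ []) (r ∷ 0# ∷ [])
      numerator = ≋-trans (E₀ ∷ E₁ ∷ E₂ ∷ E₃ ∷ [])
        (solveₚ 4 (λ p₂₃ u r σ →
            let open Substitution (expressions 4) ; 𝟎 = con (+ 0) ; 𝟏 = con (+ 1) ; 𝟑 = multiple 3 in
            cubicForm ((u :* u :* u :+ 𝟑 :* (σ :* (r :* r)) :* u) :* p₂₃)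
              ((𝟑 :* (u :* u) :+ 𝟑 :* (σ :* (r :* r))) :* p₂₃) (𝟑 :* u :* p₂₃) p₂₃ ,
            scale p₂₃ (homSubst′ (cubicForm 𝟎 (𝟑 :* σ) 𝟎 𝟏) (linearForm u 𝟏) (linearForm r 𝟎)))
          (p₂₃ ∷ u ∷ r ∷ σ ∷ []))
        where
        E₀ : a * g₀ + b * h₀ ≈ (u * u * u + 3 ×1 * (σ * (r * r)) * u) * p₂₃
        E₀ = absorb (- 1#) (absorb u (solve 11 (λ g₀ g₁ g₂ g₃ h₀ h₁ h₂ h₃ u r σ →
            let module P = Pencil (expressions 11) g₀ g₁ g₂ g₃ h₀ h₁ h₂ h₃
                open Substitution (expressions 11) ; 𝟐 = multiple 2 ; 𝟑 = multiple 3 in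
            (𝟑 :* u :* h₃ :- h₂) :* g₀ :+ (g₂ :- 𝟑 :* u :* g₃) :* h₀ :=
            (u :* u :* u :+ 𝟑 :* (σ :* (r :* r)) :* u) :* P.p₂₃
              :+ :- con (+ 1) :* (P.p₀₂ :- 𝟐 :* u :* (u :* u :- σ :* (r :* r)) :* P.p₂₃)
              :+ u :* (𝟑 :* P.p₀₃ :- (𝟑 :* (u :* u) :+ σ :* (r :* r)) :* P.p₂₃)) env) p₀₃≈) p₀₂≈

        E₁ : a * g₁ + b * h₁ ≈ (3 ×1 * (u * u) + 3 ×1 * (σ * (r * r))) * p₂₃
        E₁ = absorb (- 1#) (absorb (3 ×1 * u) (solve 11 (λ g₀ g₁ g₂ g₃ h₀ h₁ h₂ h₃ u r σ →
            let module P = Pencil (expressions 11) g₀ g₁ g₂ g₃ h₀ h₁ h₂ h₃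
                open Substitution (expressions 11) ; 𝟐 = multiple 2 ; 𝟑 = multiple 3 in
            (𝟑 :* u :* h₃ :- h₂) :* g₁ :+ (g₂ :- 𝟑 :* u :* g₃) :* h₁ :=
            (𝟑 :* (u :* u) :+ 𝟑 :* (σ :* (r :* r))) :* P.p₂₃
              :+ :- con (+ 1) :* (P.p₁₂ :- 𝟑 :* (u :* u :- σ :* (r :* r)) :* P.p₂₃)
              :+ 𝟑 :* u :* (P.p₁₃ :- 𝟐 :* u :* P.p₂₃)) env) p₁₃≈) p₁₂≈

        E₂ : a * g₂ + b * h₂ ≈ 3 ×1 * u * p₂₃
        E₂ = solve 6 (λ 𝟑 u g₂ g₃ h₂ h₃ →
            (𝟑 :* u :* h₃ :- h₂) :* g₂ :+ (g₂ :- 𝟑 :* u :* g₃) :* h₂ := 𝟑 :* u :* (g₂ :* h₃ :- g₃ :* h₂))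
          (3 ×1 ∷ u ∷ g₂ ∷ g₃ ∷ h₂ ∷ h₃ ∷ [])

        E₃ : a * g₃ + b * h₃ ≈ p₂₃
        E₃ = solve 6 (λ 𝟑 u g₂ g₃ h₂ h₃ →
            (𝟑 :* u :* h₃ :- h₂) :* g₃ :+ (g₂ :- 𝟑 :* u :* g₃) :* h₃ := g₂ :* h₃ :- g₃ :* h₂)
          (3 ×1 ∷ u ∷ g₂ ∷ g₃ ∷ h₂ ∷ h₃ ∷ [])

      denominator : (c′ ·ₚ G) +ₚ (d ·ₚ H) ≋
        p₂₃ ·ₚ homSubst F (σ ∷ 0# ∷ 3 ×1 ∷ 0# ∷ []) (u ∷ 1# ∷ []) (r ∷ 0# ∷ [])
      denominator = ≋-trans (E₀ ∷ E₁ ∷ E₂ ∷ E₃ ∷ [])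
        (solveₚ 4 (λ p₂₃ u r σ →
            let open Substitution (expressions 4) ; 𝟎 = con (+ 0) ; 𝟏 = con (+ 1) ; 𝟑 = multiple 3 in
            cubicForm (r :* ((𝟑 :* (u :* u) :+ σ :* (r :* r)) :* p₂₃)) (𝟑 :* r :* (multiple 2 :* u :* p₂₃)) (𝟑 :* r :* p₂₃) 𝟎 ,
            scale p₂₃ (homSubst′ (cubicForm σ 𝟎 𝟑 𝟎) (linearForm u 𝟏) (linearForm r 𝟎)))
          (p₂₃ ∷ u ∷ r ∷ σ ∷ []))
        where
        rearrange : ∀ v w → c′ * v + d * w ≈ 3 ×1 * r * (v * h₃ - g₃ * w)
        rearrange v w = solve 6 (λ 𝟑 r g₃ h₃ v w →
            𝟑 :* r :* h₃ :* v :+ (:- (𝟑 :* r :* g₃)) :* w := 𝟑 :* r :* (v :* h₃ :- g₃ :* w))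
          (3 ×1 ∷ r ∷ g₃ ∷ h₃ ∷ v ∷ w ∷ [])

        E₀ : c′ * g₀ + d * h₀ ≈ r * ((3 ×1 * (u * u) + σ * (r * r)) * p₂₃)
        E₀ = trans (rearrange g₀ h₀) (trans
          (solve 3 (λ 𝟑 r p → 𝟑 :* r :* p := r :* (𝟑 :* p)) (3 ×1 ∷ r ∷ p₀₃ ∷ []))
          (*-congˡ (x∙y⁻¹≈ε⇒x≈y _ _ p₀₃≈)))

        E₁ : c′ * g₁ + d * h₁ ≈ 3 ×1 * r * (2 ×1 * u * p₂₃)
        E₁ = trans (rearrange g₁ h₁) (*-congˡ (x∙y⁻¹≈ε⇒x≈y _ _ p₁₃≈))

        E₂ : c′ * g₂ + d * h₂ ≈ 3 ×1 * r * p₂₃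
        E₂ = rearrange g₂ h₂

        E₃ : c′ * g₃ + d * h₃ ≈ 0#
        E₃ = trans (rearrange g₃ h₃) (y≈0⇒x*y≈0 (-‿inverseʳ _))

    conjugatePoints : EquivalentOver F ((g₀ ∷ g₁ ∷ g₂ ∷ g₃ ∷ []) / (h₀ ∷ h₁ ∷ h₂ ∷ h₃ ∷ [])) (nf₂ F σ)
    conjugatePoints = equivalent 1# u 0# r p₂₃
      (λ Δ≈0 → r≉0 (trans (solve 2 (λ u r → r := con (+ 1) :* r :- u :* con (+ 0)) (u ∷ r ∷ [])) Δ≈0))
      (λ det≈0 → x*y≉0 (x*y≉0 3≉0 r≉0) p₂₃≉0 (begin
        3 ×1 * r * p₂₃           ≈⟨ solve 7 (λ 𝟑 u r g₂ g₃ h₂ h₃ →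
            𝟑 :* r :* (g₂ :* h₃ :- g₃ :* h₂) :=
            :- ((𝟑 :* u :* h₃ :- h₂) :* (:- (𝟑 :* r :* g₃)) :- (g₂ :- 𝟑 :* u :* g₃) :* (𝟑 :* r :* h₃)))
          (3 ×1 ∷ u ∷ r ∷ g₂ ∷ g₃ ∷ h₂ ∷ h₃ ∷ []) ⟩
        - (a * d - b * c′)       ≈⟨ trans (-‿cong det≈0) -0#≈0# ⟩
        0#                       ∎))
      numerator denominator

  -- The hypotheses are the relations between the Plücker coordinates of the
  -- pencil imposed by a ramification point of index 3 which is a root of the
  -- irreducible polynomial x² + 2 u x + t.
  conjugate-pencil : ¬ p₁₂ ≈ 0# → p₁₂ * p₁₂ ≈ 3 ×1 * p₂₃ * (3 ×1 * p₀₁) →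
    p₁₂ * p₁₃ ≈ p₂₃ * (3 ×1 * p₀₂) →
    ∀ u t → 2 ×1 * u * p₁₂ ≈ 3 ×1 * p₀₂ → t * p₁₂ ≈ 3 ×1 * p₀₁ →
    (∀ r → ¬ r * r ≈ u * u - t) →
    EquivalentOver F ((g₀ ∷ g₁ ∷ g₂ ∷ g₃ ∷ []) / (h₀ ∷ h₁ ∷ h₂ ∷ h₃ ∷ [])) (nf₂ F σ)
  conjugate-pencil p₁₂≉0 e₀ e₁ u t u-def t-def irreducible with square-or-σ*square nonsquare (u * u - t)
    where open FiniteFieldSquares F finite
  ... | inj₁ (r , rr≈) = ⊥-elim (irreducible r rr≈)
  ... | inj₂ (r , σrr≈) = conjugatePoints u r p₂₃≉0 r≉0
          (x≈y⇒x-y≈0 p₁₃≈)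
          (x≈y⇒x-y≈0 (trans p₁₂≈ (*-congʳ (*-congˡ t≈))))
          (x≈y⇒x-y≈0 (trans p₀₂≈ (*-congʳ (*-congˡ t≈))))
          (x≈y⇒x-y≈0 (trans p₀₃≈ (*-congʳ 4uu-t≈)))
    where
    r≉0 : ¬ r ≈ 0#
    r≉0 r≈0 = irreducible 0# (trans (zeroˡ 0#) (trans (sym (y≈0⇒x*y≈0 (x≈0⇒x*y≈0 r≈0))) σrr≈))

    p₁₂≈ : p₁₂ ≈ 3 ×1 * t * p₂₃
    p₁₂≈ = *-cancelˡ p₁₂≉0 (begin
      p₁₂ * p₁₂                       ≈⟨ e₀ ⟩
      3 ×1 * p₂₃ * (3 ×1 * p₀₁)       ≈⟨ *-congˡ t-def ⟨
      3 ×1 * p₂₃ * (t * p₁₂)          ≈⟨ solve 4 (λ 𝟑 p t q → 𝟑 :* p :* (t :* q) := q :* (𝟑 :* t :* p)) (3 ×1 ∷ p₂₃ ∷ t ∷ p₁₂ ∷ []) ⟩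
      p₁₂ * (3 ×1 * t * p₂₃)          ∎)

    p₂₃≉0 : ¬ p₂₃ ≈ 0#
    p₂₃≉0 p₂₃≈0 = p₁₂≉0 (trans p₁₂≈ (y≈0⇒x*y≈0 p₂₃≈0))

    p₁₃≈ : p₁₃ ≈ 2 ×1 * u * p₂₃
    p₁₃≈ = *-cancelˡ p₁₂≉0 (begin
      p₁₂ * p₁₃                       ≈⟨ e₁ ⟩
      p₂₃ * (3 ×1 * p₀₂)              ≈⟨ *-congˡ u-def ⟨
      p₂₃ * (2 ×1 * u * p₁₂)          ≈⟨ solve 3 (λ p q v → p :* (v :* q) := q :* (v :* p)) (p₂₃ ∷ p₁₂ ∷ 2 ×1 * u ∷ []) ⟩
      p₁₂ * (2 ×1 * u * p₂₃)          ∎)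

    p₀₂≈ : p₀₂ ≈ 2 ×1 * u * t * p₂₃
    p₀₂≈ = *-cancelˡ 3≉0 (begin
      3 ×1 * p₀₂                      ≈⟨ u-def ⟨
      2 ×1 * u * p₁₂                  ≈⟨ *-congˡ p₁₂≈ ⟩
      2 ×1 * u * (3 ×1 * t * p₂₃)     ≈⟨ solve 4 (λ 𝟑 v t p → v :* (𝟑 :* t :* p) := 𝟑 :* (v :* t :* p)) (3 ×1 ∷ 2 ×1 * u ∷ t ∷ p₂₃ ∷ []) ⟩
      3 ×1 * (2 ×1 * u * t * p₂₃)     ∎)

    p₀₁≈ : p₀₁ ≈ t * t * p₂₃
    p₀₁≈ = *-cancelˡ 3≉0 (begin
      3 ×1 * p₀₁                      ≈⟨ t-def ⟨
      t * p₁₂                         ≈⟨ *-congˡ p₁₂≈ ⟩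
      t * (3 ×1 * t * p₂₃)            ≈⟨ solve 3 (λ 𝟑 t p → t :* (𝟑 :* t :* p) := 𝟑 :* (t :* t :* p)) (3 ×1 ∷ t ∷ p₂₃ ∷ []) ⟩
      3 ×1 * (t * t * p₂₃)            ∎)

    -- The coordinate p₀₃ occurs in none of W₁₂, V, U; the Plücker relation recovers it from the
    -- others.
    p₀₃≈ : 3 ×1 * p₀₃ ≈ (4 ×1 * (u * u) - t) * p₂₃
    p₀₃≈ = *-cancelˡ p₁₂≉0 (begin
      p₁₂ * (3 ×1 * p₀₃)
        ≈⟨ solve 7 (λ 𝟑 p₀₁ p₀₂ p₀₃ p₁₂ p₁₃ p₂₃ → p₁₂ :* (𝟑 :* p₀₃) :=
              𝟑 :* (p₀₂ :* p₁₃ :- p₀₁ :* p₂₃) :+ 𝟑 :* (p₀₁ :* p₂₃ :- p₀₂ :* p₁₃ :+ p₀₃ :* p₁₂))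
            (3 ×1 ∷ p₀₁ ∷ p₀₂ ∷ p₀₃ ∷ p₁₂ ∷ p₁₃ ∷ p₂₃ ∷ []) ⟩
      3 ×1 * (p₀₂ * p₁₃ - p₀₁ * p₂₃) + 3 ×1 * (p₀₁ * p₂₃ - p₀₂ * p₁₃ + p₀₃ * p₁₂)
        ≈⟨ trans (+-congˡ (y≈0⇒x*y≈0 plücker)) (+-identityʳ _) ⟩
      3 ×1 * (p₀₂ * p₁₃ - p₀₁ * p₂₃)
        ≈⟨ *-congˡ (+-cong (*-cong p₀₂≈ p₁₃≈) (-‿cong (*-congʳ p₀₁≈))) ⟩
      3 ×1 * (2 ×1 * u * t * p₂₃ * (2 ×1 * u * p₂₃) - t * t * p₂₃ * p₂₃)
        ≈⟨ solve 3 (λ u t p → let open Substitution (expressions 3) ; 𝟐 = multiple 2 ; 𝟑 = multiple 3 in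
              𝟑 :* (𝟐 :* u :* t :* p :* (𝟐 :* u :* p) :- t :* t :* p :* p) :=
              𝟑 :* t :* p :* ((multiple 4 :* (u :* u) :- t) :* p)) (u ∷ t ∷ p₂₃ ∷ []) ⟩
      3 ×1 * t * p₂₃ * ((4 ×1 * (u * u) - t) * p₂₃)
        ≈⟨ *-congʳ p₁₂≈ ⟨
      p₁₂ * ((4 ×1 * (u * u) - t) * p₂₃) ∎)
      where open PencilIdentities commutativeRing g₀ g₁ g₂ g₃ h₀ h₁ h₂ h₃

    t≈ : t ≈ u * u - σ * (r * r)
    t≈ = trans (solve 2 (λ u t → t := u :* u :- (u :* u :- t)) (u ∷ t ∷ [])) (+-congˡ (-‿cong (sym σrr≈)))

    4uu-t≈ : 4 ×1 * (u * u) - t ≈ 3 ×1 * (u * u) + σ * (r * r)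
    4uu-t≈ = trans (solve 2 (λ u t → let open Substitution (expressions 2) in
        multiple 4 :* (u :* u) :- t := multiple 3 :* (u :* u) :+ (u :* u :- t)) (u ∷ t ∷ [])) (+-congˡ (sym σrr≈))

-- Double roots of the Wronskian

module Cubic {c ℓ c' ℓ'} (F : Field c ℓ) (finite : IsFinite F) (char≥5 : CharAtLeast5 F)
  (σ : Field.Carrier F) (nonsquare : IsNonSquare F σ)
  (g₀ g₁ g₂ g₃ h₀ h₁ h₂ h₃ : Field.Carrier F)
  (cubic : IsCubic F ((g₀ ∷ g₁ ∷ g₂ ∷ g₃ ∷ []) / (h₀ ∷ h₁ ∷ h₂ ∷ h₃ ∷ [])))
  (K : Field c' ℓ') (closed : IsAlgClosed K)
  (ι : Field.Carrier F → Field.Carrier K) (ι-hom : IsFieldHom F K ι) where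
  private
    module K where
      open Field K public
      open PolyOps commutativeRing public
      open PolyEvaluation commutativeRing public
      open PolyEquality commutativeRing public
      open FieldProperties K public
      open IntegerSolver commutativeRing public

    R : RatExpr F
    R = (g₀ ∷ g₁ ∷ g₂ ∷ g₃ ∷ []) / (h₀ ∷ h₁ ∷ h₂ ∷ h₃ ∷ [])

  open Field F
  open PolyOps commutativeRing
  open PolyEvaluation commutativeRing using (deriv)
  open PolyEquality commutativeRing
  open FieldProperties F
  open IntegerSolver commutativeRing
  open Equivalence F
  open NormalForms F finite char≥5 σ nonsquare
  open ConjugatePoints F finite char≥5 σ nonsquare g₀ g₁ g₂ g₃ h₀ h₁ h₂ h₃
  open Pencil commutativeRing g₀ g₁ g₂ g₃ h₀ h₁ h₂ h₃
  open PencilIdentities commutativeRing g₀ g₁ g₂ g₃ h₀ h₁ h₂ h₃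
  open Taylor F
  open Extension F K ι ι-hom

  _IsRootOf_ : K.Carrier → Poly → Set ℓ'
  x IsRootOf p = evalAt x p K.≈ K.0#

  module _ {x : K.Carrier} where
    root-cong : ∀ p q → p ≈ₚ q → x IsRootOf p → x IsRootOf q
    root-cong p q p≈q root = K.trans (K.sym (evalAt-cong x p q p≈q)) root

    root-+ : ∀ p q → x IsRootOf p → x IsRootOf q → x IsRootOf (p +ₚ q)
    root-+ p q p-root q-root = K.trans (evalAt-+ x p q) (K.x+y≈0 p-root q-root)

    root-· : ∀ a p → x IsRootOf p → x IsRootOf (a ·ₚ p)
    root-· a p root = K.trans (evalAt-· x a p) (K.y≈0⇒x*y≈0 root)

    root-shift : ∀ p → x IsRootOf p → x IsRootOf (0# ∷ p)
    root-shift p root = K.trans (evalAt-shift x p) (K.y≈0⇒x*y≈0 root)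

    root-*ˡ : ∀ p q → x IsRootOf p → x IsRootOf (p *ₚ q)
    root-*ˡ p q root = K.trans (evalAt-* x p q) (K.x≈0⇒x*y≈0 root)

    root-*ʳ : ∀ p q → x IsRootOf q → x IsRootOf (p *ₚ q)
    root-*ʳ p q root = K.trans (evalAt-* x p q) (K.y≈0⇒x*y≈0 root)

    root-cancel-· : ∀ {a} → ¬ a ≈ 0# → ∀ p → x IsRootOf (a ·ₚ p) → x IsRootOf p
    root-cancel-· a≉0 p root = K.x*y≈0⇒y≈0 (λ ιa≈0 → a≉0 (ι-injective ιa≈0))
      (K.trans (K.sym (evalAt-· x _ p)) root)

    root-split : ∀ p q → x IsRootOf (p *ₚ q) → x IsRootOf p ⊎ x IsRootOf q
    root-split p q root with evalAt x p K.≟ K.0#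
    ... | yes p-root = inj₁ p-root
    ... | no  p≉0    = inj₂ (K.x*y≈0⇒y≈0 p≉0 (K.trans (K.sym (evalAt-* x p q)) root))

    -- By coprimality d k = 1 for some k, and evaluating at the root x of d gives 1 = 0 in K.
    no-common-factor : ∀ d → x IsRootOf d → d ∣ₚ G → d ∣ₚ H → ⊥
    no-common-factor d root d∣G d∣H with k , dk≈1 ← proj₁ cubic d d∣G d∣H = K.1≉0 (begin
      K.1#                            ≈⟨ 1#-homo ⟨
      ι 1#                            ≈⟨ K.trans (K.+-congˡ (K.zeroʳ x)) (K.+-identityʳ _) ⟨
      evalAt x (1# ∷ [])              ≈⟨ root-cong (d *ₚ k) (1# ∷ []) dk≈1 (root-*ˡ d k root) ⟩
      K.0#                            ∎)
      where open import Relation.Binary.Reasoning.Setoid K.setoid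

    -- The remainder has degree at most one and vanishes at the irrational x, so it is zero.
    quadratic-divides : Irrational x → ∀ {s t} → x IsRootOf (t ∷ s ∷ 1# ∷ []) →
      ∀ {a₀ a₁ a₂ a₃} → let A = a₀ ∷ a₁ ∷ a₂ ∷ a₃ ∷ [] in
      x IsRootOf A → (t ∷ s ∷ 1# ∷ []) ∣ₚ A
    quadratic-divides x∉F {s} {t} Q-root {a₀} {a₁} {a₂} {a₃} A-root
      = q , ≋⇒≈ₚ (drop division (proj₁ r≈0) (proj₂ r≈0))
      where
      q r : Poly
      q = a₂ - s * a₃ ∷ a₃ ∷ []
      r = a₀ - t * (a₂ - s * a₃) ∷ a₁ - t * a₃ - s * (a₂ - s * a₃) ∷ []

      remainder-root : ((t ∷ s ∷ 1# ∷ []) *ₚ q) +ₚ r ≋ (a₀ ∷ a₁ ∷ a₂ ∷ a₃ ∷ []) → x IsRootOf r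
      remainder-root eq = begin
        evalAt x r                                            ≈⟨ K.+-identityˡ _ ⟨
        K.0# K.+ evalAt x r                                   ≈⟨ K.+-congʳ (root-*ˡ (t ∷ s ∷ 1# ∷ []) q Q-root) ⟨
        evalAt x ((t ∷ s ∷ 1# ∷ []) *ₚ q) K.+ evalAt x r      ≈⟨ evalAt-+ x ((t ∷ s ∷ 1# ∷ []) *ₚ q) r ⟨
        evalAt x (((t ∷ s ∷ 1# ∷ []) *ₚ q) +ₚ r)              ≈⟨ evalAt-cong x (((t ∷ s ∷ 1# ∷ []) *ₚ q) +ₚ r) (a₀ ∷ a₁ ∷ a₂ ∷ a₃ ∷ []) (≋⇒≈ₚ eq) ⟩
        evalAt x (a₀ ∷ a₁ ∷ a₂ ∷ a₃ ∷ [])                     ≈⟨ A-root ⟩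
        K.0#                                                  ∎
        where open import Relation.Binary.Reasoning.Setoid K.setoid

      division : ((t ∷ s ∷ 1# ∷ []) *ₚ q) +ₚ r ≋ (a₀ ∷ a₁ ∷ a₂ ∷ a₃ ∷ [])
      division = quadratic-division a₀ a₁ a₂ a₃ s t

      r≈0 : a₀ - t * (a₂ - s * a₃) ≈ 0# × a₁ - t * a₃ - s * (a₂ - s * a₃) ≈ 0#
      r≈0 = irrational-linear x∉F _ _ (remainder-root division)

      drop : ∀ {q₀ q₁ q₂ q₃ r₀ r₁ a₀ a₁ a₂ a₃} →
        (q₀ + r₀ ∷ q₁ + r₁ ∷ q₂ ∷ q₃ ∷ []) ≋ (a₀ ∷ a₁ ∷ a₂ ∷ a₃ ∷ []) →
        r₀ ≈ 0# → r₁ ≈ 0# → (q₀ ∷ q₁ ∷ q₂ ∷ q₃ ∷ []) ≋ (a₀ ∷ a₁ ∷ a₂ ∷ a₃ ∷ [])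
      drop (e₀ ∷ e₁ ∷ es) r₀≈0 r₁≈0 =
        trans (sym (trans (+-congˡ r₀≈0) (+-identityʳ _))) e₀ ∷
        trans (sym (trans (+-congˡ r₁≈0) (+-identityʳ _))) e₁ ∷ es

  linear-divides : ∀ y {a₀ a₁ a₂ a₃} → let A = a₀ ∷ a₁ ∷ a₂ ∷ a₃ ∷ [] in
    eval A y ≈ 0# → (- y ∷ 1# ∷ []) ∣ₚ A
  linear-divides y {a₀} {a₁} {a₂} {a₃} root =
    a₁ + y * (a₂ + y * a₃) ∷ a₂ + y * a₃ ∷ a₃ ∷ [] ,
    ≋⇒≈ₚ (≋-trans (linear-factor a₀ a₁ a₂ a₃ y) (absorb (- 1#) refl root ∷ refl ∷ refl ∷ refl ∷ []))

  constant-factor : ∀ k a₀ a₁ a₂ a₃ → let A = a₀ ∷ a₁ ∷ a₂ ∷ a₃ ∷ [] in A *ₚ (k ∷ []) ≋ k ·ₚ A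
  constant-factor k a₀ a₁ a₂ a₃ = solveₚ 5 (λ k a₀ a₁ a₂ a₃ →
      let open Substitution (expressions 5) ; a = cubicForm a₀ a₁ a₂ a₃ in
      multiply a (k ∷ []) , scale k a)
    (k ∷ a₀ ∷ a₁ ∷ a₂ ∷ a₃ ∷ [])

  ∣ₚ-refl : ∀ {a₀ a₁ a₂ a₃} → let A = a₀ ∷ a₁ ∷ a₂ ∷ a₃ ∷ [] in A ∣ₚ A
  ∣ₚ-refl = 1# ∷ [] , ≋⇒≈ₚ (≋-trans (constant-factor 1# _ _ _ _)
    (*-identityˡ _ ∷ *-identityˡ _ ∷ *-identityˡ _ ∷ *-identityˡ _ ∷ []))

  proportional-divides : ∀ {a₀ a₁ a₂ a₃ b₀ b₁ b₂ b₃} → ¬ a₃ ≈ 0# →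
    a₀ * b₃ ≈ a₃ * b₀ → a₁ * b₃ ≈ a₃ * b₁ → a₂ * b₃ ≈ a₃ * b₂ →
    (a₀ ∷ a₁ ∷ a₂ ∷ a₃ ∷ []) ∣ₚ (b₀ ∷ b₁ ∷ b₂ ∷ b₃ ∷ [])
  proportional-divides {a₀} {a₁} {a₂} {a₃} {b₀} {b₁} {b₂} {b₃} a₃≉0 e₀ e₁ e₂ with i , a₃i≈1 ← inverse a₃ a₃≉0 =
    b₃ * i ∷ [] , ≋⇒≈ₚ (≋-trans (constant-factor (b₃ * i) a₀ a₁ a₂ a₃)
      (divide e₀ ∷ divide e₁ ∷ divide e₂ ∷ divide refl ∷ []))
    where
    open import Relation.Binary.Reasoning.Setoid setoid
    divide : ∀ {a b} → a * b₃ ≈ a₃ * b → b₃ * i * a ≈ b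
    divide {a} {b} e = begin
      b₃ * i * a        ≈⟨ solve 3 (λ a b₃ i → b₃ :* i :* a := i :* (a :* b₃)) (a ∷ b₃ ∷ i ∷ []) ⟩
      i * (a * b₃)      ≈⟨ *-congˡ e ⟩
      i * (a₃ * b)      ≈⟨ solve 3 (λ a₃ b i → i :* (a₃ :* b) := (a₃ :* i) :* b) (a₃ ∷ b ∷ i ∷ []) ⟩
      a₃ * i * b        ≈⟨ trans (*-congʳ a₃i≈1) (*-identityˡ b) ⟩
      b                 ∎

  -- If these minors vanish, whichever of G and H has a nonzero X³-coefficient divides the other. It
  -- has a root in K, which contradicts coprimality.
  independent : ¬ (p₀₃ ≈ 0# × p₁₃ ≈ 0# × p₂₃ ≈ 0#)
  independent (p₀₃≈0 , p₁₃≈0 , p₂₃≈0) with g₃ ≟ 0#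
  ... | no g₃≉0 with x , root ← closed (ι g₀) (ι g₁ ∷ ι g₂ ∷ []) (ι g₃) (λ ιg₃≈0 → g₃≉0 (ι-injective ιg₃≈0)) =
    no-common-factor G root ∣ₚ-refl (proportional-divides g₃≉0
      (x∙y⁻¹≈ε⇒x≈y _ _ p₀₃≈0) (x∙y⁻¹≈ε⇒x≈y _ _ p₁₃≈0) (x∙y⁻¹≈ε⇒x≈y _ _ p₂₃≈0))
  ... | yes g₃≈0 with h₃ ≟ 0#
  ... | yes h₃≈0 = proj₂ cubic (g₃≈0 , h₃≈0)
  ... | no h₃≉0 with x , root ← closed (ι h₀) (ι h₁ ∷ ι h₂ ∷ []) (ι h₃) (λ ιh₃≈0 → h₃≉0 (ι-injective ιh₃≈0)) =
    no-common-factor H root (proportional-divides h₃≉0 (flip p₀₃≈0) (flip p₁₃≈0) (flip p₂₃≈0)) ∣ₚ-refl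
    where
    flip : ∀ {a b} → a * h₃ - g₃ * b ≈ 0# → b * g₃ ≈ h₃ * a
    flip e = trans (*-comm _ _) (trans (sym (x∙y⁻¹≈ε⇒x≈y _ _ e)) (*-comm _ _))

  -- Finiteness of F reduces the question to a search through the enumeration.
  rational? : ∀ x → (∃[ y ] ι y K.≈ x) ⊎ Irrational x
  rational? x with Any.any? (λ y → ι y K.≟ x) (proj₁ finite)
  ... | yes found = inj₁ (Any.satisfied found)
  ... | no  none  = inj₂ λ y ιy≈x →
    none (Any.map (λ y≈z → K.trans (⟦⟧-cong (sym y≈z)) ιy≈x) (proj₂ finite y))

  rational-root : ∀ {x y} → ι y K.≈ x → ∀ p → x IsRootOf p → eval p y ≈ 0#
  rational-root {x} {y} ιy≈x p root = ι-injective (K.trans (K.sym (evalAt-ι p y))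
    (K.trans (K.eval-congʳ (List.map ι p) ιy≈x) root))

  -- A common divisor over F has to be produced from a root in K. For rational x it is X - x.
  -- Otherwise h₃ G - g₃ H is a polynomial of degree at most two vanishing at x; it is not zero by
  -- `independent`, hence of degree exactly two, and made monic it divides both G and H.
  no-common-root : ∀ x → x IsRootOf G → x IsRootOf H → ⊥
  no-common-root x G-root H-root with rational? x
  ... | inj₁ (y , ιy≈x) = no-common-factor (- y ∷ 1# ∷ []) root
          (linear-divides y (rational-root ιy≈x G G-root)) (linear-divides y (rational-root ιy≈x H H-root))
    where
    root : x IsRootOf (- y ∷ 1# ∷ [])
    root = K.trans (K.+-cong (K.trans (-‿homo y) (K.-‿cong ιy≈x)) (K.*-congˡ (K.+-congʳ 1#-homo)))
      (K.solve 1 (λ x → K.:- x K.:+ x K.:* (K.con (+ 1) K.:+ x K.:* K.con (+ 0)) K.:= K.con (+ 0)) (x ∷ []))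
  ... | inj₂ x∉F with p₂₃ ≟ 0#
  ... | yes p₂₃≈0 = independent (p₀₃≈0,p₁₃≈0 .proj₁ , p₀₃≈0,p₁₃≈0 .proj₂ , p₂₃≈0)
    where
    p₀₃≈0,p₁₃≈0 : p₀₃ ≈ 0# × p₁₃ ≈ 0#
    p₀₃≈0,p₁₃≈0 = irrational-linear x∉F p₀₃ p₁₃ (root-cong (p₀₃ ∷ p₁₃ ∷ p₂₃ ∷ []) (p₀₃ ∷ p₁₃ ∷ [])
      (refl , refl , p₂₃≈0 , _)
      (root-cong ((h₃ ·ₚ G) +ₚ ((- g₃) ·ₚ H)) (p₀₃ ∷ p₁₃ ∷ p₂₃ ∷ []) eliminate-X³ (root-+ (h₃ ·ₚ G) ((- g₃) ·ₚ H) (root-· h₃ G G-root) (root-· (- g₃) H H-root))))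
  ... | no  p₂₃≉0 with i , p₂₃i≈1 ← inverse p₂₃ p₂₃≉0 =
    no-common-factor (i * p₀₃ ∷ i * p₁₃ ∷ 1# ∷ []) Q-root (quadratic-divides x∉F Q-root G-root) (quadratic-divides x∉F Q-root H-root)
    where
    Q-root : x IsRootOf (i * p₀₃ ∷ i * p₁₃ ∷ 1# ∷ [])
    Q-root = root-cong (i ·ₚ (p₀₃ ∷ p₁₃ ∷ p₂₃ ∷ [])) (i * p₀₃ ∷ i * p₁₃ ∷ 1# ∷ []) (refl , refl , trans (*-comm i p₂₃) p₂₃i≈1 , _)
      (root-· i (p₀₃ ∷ p₁₃ ∷ p₂₃ ∷ []) (root-cong ((h₃ ·ₚ G) +ₚ ((- g₃) ·ₚ H)) (p₀₃ ∷ p₁₃ ∷ p₂₃ ∷ []) eliminate-X³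
        (root-+ (h₃ ·ₚ G) ((- g₃) ·ₚ H) (root-· h₃ G G-root) (root-· (- g₃) H H-root))))

  module _ {v₀ v₁ v₂ v₃ w₀ w₁ w₂ w₃ m₀ m₁ l₀ l₁ : Carrier}
    (G≋ : G ≋ homSubst F (v₀ ∷ v₁ ∷ v₂ ∷ v₃ ∷ []) (m₀ ∷ m₁ ∷ []) (l₀ ∷ l₁ ∷ []))
    (H≋ : H ≋ homSubst F (w₀ ∷ w₁ ∷ w₂ ∷ w₃ ∷ []) (m₀ ∷ m₁ ∷ []) (l₀ ∷ l₁ ∷ []))
    (v₃w₃≉0 : ¬ (v₃ ≈ 0# × w₃ ≈ 0#))
    (e₂≈0 : w₃ * v₂ - v₃ * w₂ ≈ 0#)
    (e₁≈0 : w₃ * v₁ - v₃ * w₁ ≈ 0#)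
    where

    -- Since w₃ G - v₃ H = κ l³, a vanishing `κ` would make G and H proportional.
    κ≉0 : ¬ w₃ * v₀ - v₃ * w₀ ≈ 0#
    κ≉0 κ≈0 = contradict proportional
      where
      minus : ∀ v w → w₃ * v + - v₃ * w ≈ w₃ * v - v₃ * w
      minus v w = solve 4 (λ v₃ w₃ v w → w₃ :* v :+ (:- v₃) :* w := w₃ :* v :- v₃ :* w) (v₃ ∷ w₃ ∷ v ∷ w ∷ [])

      proportional : (w₃ ·ₚ G) +ₚ ((- v₃) ·ₚ H) ≋ (0# ∷ 0# ∷ 0# ∷ 0# ∷ [])
      proportional = ≋-trans (+ₚ-cong (·ₚ-cong refl G≋) (·ₚ-cong refl H≋))
        (≋-trans (homSubst-linear w₃ (- v₃) m₀ m₁ l₀ l₁)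
        (≋-trans (homSubst-cong (m₀ ∷ m₁ ∷ []) (l₀ ∷ l₁ ∷ [])
          (trans (minus v₀ w₀) κ≈0 ∷ trans (minus v₁ w₁) e₁≈0 ∷ trans (minus v₂ w₂) e₂≈0 ∷
           trans (minus v₃ w₃) (x≈y⇒x-y≈0 (*-comm w₃ v₃)) ∷ []))
        (solveₚ 4 (λ m₀ m₁ l₀ l₁ →
            let open Substitution (expressions 4) ; 𝟎 = con (+ 0) in
            homSubst′ (cubicForm 𝟎 𝟎 𝟎 𝟎) (linearForm m₀ m₁) (linearForm l₀ l₁) , cubicForm 𝟎 𝟎 𝟎 𝟎)
          (m₀ ∷ m₁ ∷ l₀ ∷ l₁ ∷ []))))

      minor≈0 : ∀ {a b} → w₃ * a + - v₃ * b ≈ 0# → w₃ * g₃ + - v₃ * h₃ ≈ 0# → a * h₃ - g₃ * b ≈ 0#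
      minor≈0 {a} {b} e e₃ with v₃ ≟ 0#
      ... | no v₃≉0 = x*y≈0⇒y≈0 v₃≉0 (trans
              (solve 6 (λ a b g₃ h₃ v₃ w₃ → v₃ :* (a :* h₃ :- g₃ :* b) :=
                  g₃ :* (w₃ :* a :+ (:- v₃) :* b) :+ (:- a) :* (w₃ :* g₃ :+ (:- v₃) :* h₃))
                (a ∷ b ∷ g₃ ∷ h₃ ∷ v₃ ∷ w₃ ∷ []))
              (x+y≈0 (y≈0⇒x*y≈0 e) (y≈0⇒x*y≈0 e₃)))
      ... | yes v₃≈0 = x*y≈0⇒y≈0 (λ w₃≈0 → v₃w₃≉0 (v₃≈0 , w₃≈0)) (trans
              (solve 6 (λ a b g₃ h₃ v₃ w₃ → w₃ :* (a :* h₃ :- g₃ :* b) :=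
                  h₃ :* (w₃ :* a :+ (:- v₃) :* b) :+ (:- b) :* (w₃ :* g₃ :+ (:- v₃) :* h₃))
                (a ∷ b ∷ g₃ ∷ h₃ ∷ v₃ ∷ w₃ ∷ []))
              (x+y≈0 (y≈0⇒x*y≈0 e) (y≈0⇒x*y≈0 e₃)))

      contradict : (w₃ ·ₚ G) +ₚ ((- v₃) ·ₚ H) ≋ (0# ∷ 0# ∷ 0# ∷ 0# ∷ []) → ⊥
      contradict (e₀ ∷ e₁ ∷ e₂ ∷ e₃ ∷ []) =
        independent (minor≈0 e₀ e₃ , minor≈0 e₁ e₃ , minor≈0 e₂ e₃)

    triplePoint′ : ¬ m₁ * l₀ - m₀ * l₁ ≈ 0# → OneOfNormalForms R
    triplePoint′ m∦l = triplePoint G≋ H≋ m∦l e₂≈0 e₁≈0 κ≉0 v₃w₃≉0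

  -- The two top coefficients of W are 2 p₁₃ and p₂₃, so this is a double root at infinity. With m =
  -- X and l = Y the coordinates of G and H are their own coefficients.
  triplePoint-∞ : p₂₃ ≈ 0# → p₁₃ ≈ 0# → OneOfNormalForms R
  triplePoint-∞ p₂₃≈0 p₁₃≈0 = triplePoint′ (taylor-∞ g₀ g₁ g₂ g₃) (taylor-∞ h₀ h₁ h₂ h₃) (proj₂ cubic)
    (trans (+-congʳ (*-comm h₃ g₂)) p₂₃≈0) (trans (+-congʳ (*-comm h₃ g₁)) p₁₃≈0)
    (λ det≈0 → 1≉0 (trans (solve 0 (con (+ 1) := con (+ 1) :* con (+ 1) :- con (+ 0) :* con (+ 0)) []) det≈0))

  doubleRoot-W₀₂ : ∀ {x} → x IsRootOf deriv W₀₁ → x IsRootOf W₀₂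
  doubleRoot-W₀₂ root = root-cancel-· 2≉0 W₀₂ (root-cong (deriv W₀₁) (2 ×1 ·ₚ W₀₂) deriv-W₀₁ root)

  rational-doubleRoot : ∀ {x y} → ι y K.≈ x → x IsRootOf W₀₁ → x IsRootOf W₀₂ → OneOfNormalForms R
  rational-doubleRoot {x} {y} ιy≈x root₁ root₂ = triplePoint′ (taylor g₀ g₁ g₂ g₃ y) (taylor h₀ h₁ h₂ h₃ y)
    (λ (G≈0 , H≈0) → no-common-root (ι y)
      (K.trans (evalAt-ι G y) (K.trans (⟦⟧-cong G≈0) 0#-homo))
      (K.trans (evalAt-ι H y) (K.trans (⟦⟧-cong H≈0) 0#-homo)))
    (unnegate (trans (sym (eval-W₀₁ y)) (rational-root ιy≈x W₀₁ root₁)))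
    (unnegate (trans (sym (eval-W₀₂ y)) (rational-root ιy≈x W₀₂ root₂)))
    (λ det≈0 → 1≉0 (trans
      (solve 1 (λ y → con (+ 1) := :- (con (+ 0) :* (:- y) :- con (+ 1) :* con (+ 1))) (y ∷ []))
      (trans (-‿cong det≈0) -0#≈0#)))
    where
    unnegate : ∀ {a} → - a ≈ 0# → a ≈ 0#
    unnegate {a} -a≈0 = trans (solve 1 (λ a → a := :- (:- a)) (a ∷ [])) (trans (-‿cong -a≈0) -0#≈0#)

  module _ {x : K.Carrier} (x∉F : Irrational x) (root₁ : x IsRootOf W₀₁) (root₂ : x IsRootOf W₀₂) where
    -- The determinant identities show that G W₁₂ and H W₁₂ vanish at x, and G and H do not both
    -- vanish there.
    root₁₂ : x IsRootOf W₁₂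
    root₁₂ with evalAt x G K.≟ K.0#
    ... | no G≉0 = K.x*y≈0⇒y≈0 G≉0 (K.trans (K.sym (evalAt-* x G W₁₂))
            (root-cong ((G₁ *ₚ W₀₂) +ₚ ((- 1#) ·ₚ (G₂ *ₚ W₀₁))) (G *ₚ W₁₂) (≋⇒≈ₚ (≋-sym G*W₁₂)) (root-+ (G₁ *ₚ W₀₂) ((- 1#) ·ₚ (G₂ *ₚ W₀₁))
              (root-*ʳ G₁ W₀₂ root₂) (root-· (- 1#) (G₂ *ₚ W₀₁) (root-*ʳ G₂ W₀₁ root₁)))))
    ... | yes G≈0 = K.x*y≈0⇒y≈0 (no-common-root x G≈0) (K.trans (K.sym (evalAt-* x H W₁₂))
            (root-cong ((H₁ *ₚ W₀₂) +ₚ ((- 1#) ·ₚ (H₂ *ₚ W₀₁))) (H *ₚ W₁₂) (≋⇒≈ₚ (≋-sym H*W₁₂)) (root-+ (H₁ *ₚ W₀₂) ((- 1#) ·ₚ (H₂ *ₚ W₀₁))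
              (root-*ʳ H₁ W₀₂ root₂) (root-· (- 1#) (H₂ *ₚ W₀₁) (root-*ʳ H₂ W₀₁ root₁)))))

    -- Up to a constant, V is the minor formed from the partial derivatives ∂²/∂Y² and ∂²/∂X∂Y of
    -- the two forms, just as W₁₂ comes from ∂²/∂X∂Y and ∂²/∂X². It supplies the quadratic
    -- polynomial of x.
    root-V : x IsRootOf V
    root-V = root-cong ((3 ×1 ·ₚ W₀₁) +ₚ (0# ∷ (- (3 ×1)) ·ₚ W₀₂) +ₚ (0# ∷ 0# ∷ W₁₂)) V V-expand
      (root-+ ((3 ×1 ·ₚ W₀₁) +ₚ (0# ∷ (- (3 ×1)) ·ₚ W₀₂)) (0# ∷ 0# ∷ W₁₂)
        (root-+ (3 ×1 ·ₚ W₀₁) (0# ∷ (- (3 ×1)) ·ₚ W₀₂)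
          (root-· (3 ×1) W₀₁ root₁) (root-shift ((- (3 ×1)) ·ₚ W₀₂) (root-· (- (3 ×1)) W₀₂ root₂)))
        (root-shift (0# ∷ W₁₂) (root-shift W₁₂ root₁₂)))

    x≉0 : ¬ x K.≈ K.0#
    x≉0 x≈0 = x∉F 0# (K.trans 0#-homo (K.sym x≈0))

    root-unshift : ∀ {a} p → a ≈ 0# → x IsRootOf (a ∷ p) → x IsRootOf p
    root-unshift p a≈0 root = K.x*y≈0⇒y≈0 x≉0
      (K.trans (K.sym (K.trans (K.+-congʳ (K.trans (⟦⟧-cong a≈0) 0#-homo)) (K.+-identityˡ _))) root)

    -- Otherwise V is linear, and so is W₁₂ after removing a factor X; both must vanish, which kills
    -- p₀₁, p₀₂, p₁₃ and p₂₃. What is left of W₀₁ is 3 p₀₃ X², so p₀₃ = 0 too, against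
    -- `independent`.
    p₁₂≉0 : ¬ p₁₂ ≈ 0#
    p₁₂≉0 p₁₂≈0 = independent (p₀₃≈0 , p₁₃≈0 , p₂₃≈0)
      where
      p₀₁≈0×p₀₂≈0 : 3 ×1 * p₀₁ ≈ 0# × 3 ×1 * p₀₂ ≈ 0#
      p₀₁≈0×p₀₂≈0 = irrational-linear x∉F (3 ×1 * p₀₁) (3 ×1 * p₀₂)
        (root-cong V (3 ×1 * p₀₁ ∷ 3 ×1 * p₀₂ ∷ []) (refl , refl , p₁₂≈0 , _) root-V)

      p₁₃≈0×p₂₃≈0 : 3 ×1 * p₁₃ ≈ 0# × 3 ×1 * p₂₃ ≈ 0#
      p₁₃≈0×p₂₃≈0 = irrational-linear x∉F (3 ×1 * p₁₃) (3 ×1 * p₂₃)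
        (root-unshift (3 ×1 * p₁₃ ∷ 3 ×1 * p₂₃ ∷ []) p₁₂≈0 root₁₂)

      p₁₃≈0 : p₁₃ ≈ 0#
      p₁₃≈0 = x*y≈0⇒y≈0 3≉0 (proj₁ p₁₃≈0×p₂₃≈0)

      p₂₃≈0 : p₂₃ ≈ 0#
      p₂₃≈0 = x*y≈0⇒y≈0 3≉0 (proj₂ p₁₃≈0×p₂₃≈0)

      middle≈0 : 3 ×1 * p₀₃ + p₁₂ ≈ 0#
      middle≈0 = proj₁ (irrational-linear x∉F (3 ×1 * p₀₃ + p₁₂) 0#
        (root-unshift (3 ×1 * p₀₃ + p₁₂ ∷ 0# ∷ []) (y≈0⇒x*y≈0 (x*y≈0⇒y≈0 3≉0 (proj₂ p₀₁≈0×p₀₂≈0)))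
          (root-unshift (2 ×1 * p₀₂ ∷ 3 ×1 * p₀₃ + p₁₂ ∷ 0# ∷ []) (x*y≈0⇒y≈0 3≉0 (proj₁ p₀₁≈0×p₀₂≈0))
            (root-cong W₀₁ (p₀₁ ∷ 2 ×1 * p₀₂ ∷ 3 ×1 * p₀₃ + p₁₂ ∷ 0# ∷ [])
              (refl , refl , refl , y≈0⇒x*y≈0 p₁₃≈0 , p₂₃≈0 , _) root₁))))

      p₀₃≈0 : p₀₃ ≈ 0#
      p₀₃≈0 = x*y≈0⇒y≈0 3≉0 (trans (sym (trans (+-congˡ p₁₂≈0) (+-identityʳ _))) middle≈0)

    irrational-doubleRoot : EquivalentOver F R (nf₂ F σ)
    irrational-doubleRoot = conjugate-pencil p₁₂≉0 (x∙y⁻¹≈ε⇒x≈y _ _ (proj₁ U≈0))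
      (x∙y⁻¹≈ε⇒x≈y _ _ (x*y≈0⇒y≈0 3≉0 (proj₂ U≈0))) u t 2u*p₁₂ t*p₁₂ irreducible
      where
      open import Relation.Binary.Reasoning.Setoid setoid

      U≈0 : p₁₂ * p₁₂ - 3 ×1 * p₂₃ * (3 ×1 * p₀₁) ≈ 0# × 3 ×1 * (p₁₂ * p₁₃ - p₂₃ * (3 ×1 * p₀₂)) ≈ 0#
      U≈0 = irrational-linear x∉F _ _ (root-cong ((p₁₂ ·ₚ W₁₂) +ₚ ((- (3 ×1 * p₂₃)) ·ₚ V)) U U-expand
        (root-+ (p₁₂ ·ₚ W₁₂) ((- (3 ×1 * p₂₃)) ·ₚ V) (root-· p₁₂ W₁₂ root₁₂) (root-· (- (3 ×1 * p₂₃)) V root-V)))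

      i half u t : Carrier
      i = proj₁ (inverse p₁₂ p₁₂≉0)
      half = proj₁ (inverse (2 ×1) 2≉0)
      u = half * (i * (3 ×1 * p₀₂))
      t = i * (3 ×1 * p₀₁)

      p₁₂i≈1 : p₁₂ * i ≈ 1#
      p₁₂i≈1 = proj₂ (inverse p₁₂ p₁₂≉0)

      2u≈ : 2 ×1 * u ≈ i * (3 ×1 * p₀₂)
      2u≈ = trans (sym (*-assoc _ _ _)) (trans (*-congʳ (proj₂ (inverse (2 ×1) 2≉0))) (*-identityˡ _))

      undo : ∀ a → i * a * p₁₂ ≈ a
      undo a = begin
        i * a * p₁₂        ≈⟨ solve 3 (λ i a p → i :* a :* p := p :* i :* a) (i ∷ a ∷ p₁₂ ∷ []) ⟩
        p₁₂ * i * a        ≈⟨ trans (*-congʳ p₁₂i≈1) (*-identityˡ a) ⟩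
        a                  ∎

      2u*p₁₂ : 2 ×1 * u * p₁₂ ≈ 3 ×1 * p₀₂
      2u*p₁₂ = trans (*-congʳ 2u≈) (undo _)

      t*p₁₂ : t * p₁₂ ≈ 3 ×1 * p₀₁
      t*p₁₂ = undo _

      -- V / p₁₂ = X² + 2 u X + t would split as (X + u - r) (X + u + r), making x a root of a monic
      -- linear polynomial over F.
      irreducible : ∀ r → ¬ r * r ≈ u * u - t
      irreducible r rr≈ = Sum.[ no-linear , no-linear ]
        (root-split (u - r ∷ 1# ∷ []) (u + r ∷ 1# ∷ [])
          (root-cong (i ·ₚ V) ((u - r ∷ 1# ∷ []) *ₚ (u + r ∷ 1# ∷ [])) (t≈ , 2u≈′ , trans (*-comm i p₁₂) (trans p₁₂i≈1 1≈) , _) (root-· i V root-V)))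
        where
        t≈ : i * (3 ×1 * p₀₁) ≈ (u - r) * (u + r) + 0#
        t≈ = sym (trans
          (solve 3 (λ u r t → (u :- r) :* (u :+ r) :+ con (+ 0) := t :+ (u :* u :- t :- r :* r)) (u ∷ r ∷ t ∷ []))
          (trans (+-congˡ (x≈y⇒x-y≈0 (sym rr≈))) (+-identityʳ _)))

        2u≈′ : i * (3 ×1 * p₀₂) ≈ (u - r) * 1# + (1# * (u + r) + 0#)
        2u≈′ = trans (sym 2u≈) (solve 2 (λ u r → let open Substitution (expressions 2) ; 𝟏 = con (+ 1) in
          multiple 2 :* u := (u :- r) :* 𝟏 :+ (𝟏 :* (u :+ r) :+ con (+ 0))) (u ∷ r ∷ []))

        1≈ : 1# ≈ 1# * 1#
        1≈ = sym (*-identityˡ 1#)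

        no-linear : ∀ {a} → ¬ x IsRootOf (a ∷ 1# ∷ [])
        no-linear root = 1≉0 (proj₂ (irrational-linear x∉F _ _ root))

  doubleRoot : ∀ {x} → x IsRootOf W₀₁ → x IsRootOf deriv W₀₁ → OneOfNormalForms R
  doubleRoot {x} root root′ with rational? x
  ... | inj₁ (y , ιy≈x) = rational-doubleRoot ιy≈x root (doubleRoot-W₀₂ root′)
  ... | inj₂ x∉F        = inj₂ (inj₁ (irrational-doubleRoot x∉F root (doubleRoot-W₀₂ root′)))

-- Counting ramification points

module Fibre {c ℓ} (R : CommutativeRing c ℓ) (g₀ g₁ g₂ g₃ h₀ h₁ h₂ h₃ a b : CommutativeRing.Carrier R) where
  open CommutativeRing R
  open PolyOps R
  open PolyEvaluation R using (deriv)

  Gₐ Hₐ : Carrier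
  Gₐ = g₀ * (b * b * b) + g₁ * (a * b * b) + g₂ * (a * a * b) + g₃ * (a * a * a)
  Hₐ = h₀ * (b * b * b) + h₁ * (a * b * b) + h₂ * (a * a * b) + h₃ * (a * a * a)

  G H fibre square : Poly
  G = g₀ ∷ g₁ ∷ g₂ ∷ g₃ ∷ []
  H = h₀ ∷ h₁ ∷ h₂ ∷ h₃ ∷ []
  fibre = (Hₐ ·ₚ G) +ₚ ((- Gₐ) ·ₚ H)
  square = a * a ∷ - ((1# + 1#) * a * b) ∷ b * b ∷ []

  e₀ e₁ e₂ e₃ wronskian : Carrier
  e₀ = Hₐ * g₀ + - Gₐ * h₀
  e₁ = Hₐ * g₁ + - Gₐ * h₁
  e₂ = Hₐ * g₂ + - Gₐ * h₂
  e₃ = Hₐ * g₃ + - Gₐ * h₃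
  wronskian = eval G a * eval (deriv H) a - eval (deriv G) a * eval H a

  affine-cofactor : Poly
  affine-cofactor = e₂ + 2 ×1 * a * e₃ ∷ e₃ ∷ []

  -- For b = 1 this is the product of `square` and `affine-cofactor`. The fibre form vanishes at a
  -- with derivative -`wronskian`, so the product is the fibre form plus `wronskian` times X - a.
  affine-remainder : Poly
  affine-remainder = e₀ + - a * wronskian ∷ e₁ + wronskian ∷ e₂ ∷ e₃ ∷ []

  infinite-cofactor : Poly
  infinite-cofactor = e₀ ∷ e₁ ∷ []

  -- For a = 1 and b = 0 the third entry is a disguised zero, because e₂ is then that very minor.
  -- Written this way it becomes e₂ as soon as the minor vanishes.
  infinite-remainder : Poly
  infinite-remainder = e₀ ∷ e₁ ∷ e₂ - (g₂ * h₃ - g₃ * h₂) ∷ []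

module RamificationPoints {c ℓ c' ℓ'} (F : Field c ℓ) (K : Field c' ℓ')
  (ι : Field.Carrier F → Field.Carrier K) (ι-hom : IsFieldHom F K ι)
  (g₀ g₁ g₂ g₃ h₀ h₁ h₂ h₃ : Field.Carrier F) where
  private
    module F = Field F
    module Fₚ = PolyOps F.commutativeRing
  open Field K
  open PolyOps commutativeRing
  open PolyEvaluation commutativeRing
  open PolyEquality commutativeRing
  open FieldProperties K
  open IntegerSolver commutativeRing
  open Extension F K ι ι-hom
  open Pencil F.commutativeRing g₀ g₁ g₂ g₃ h₀ h₁ h₂ h₃
  open PencilIdentities F.commutativeRing g₀ g₁ g₂ g₃ h₀ h₁ h₂ h₃ using (W₀₁-expand)
  open import Relation.Binary.Reasoning.Setoid setoid

  private
    R : RatExpr F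
    R = (g₀ ∷ g₁ ∷ g₂ ∷ g₃ ∷ []) / (h₀ ∷ h₁ ∷ h₂ ∷ h₃ ∷ [])

    module Fibreₖ (a b : Carrier) = Fibre commutativeRing (ι g₀) (ι g₁) (ι g₂) (ι g₃) (ι h₀) (ι h₁) (ι h₂) (ι h₃) a b

  affine : Carrier → P¹ F K ι
  affine x = [ x ∶ 1# ]⟨ (λ (_ , 1≈0) → 1≉0 1≈0) ⟩

  infinite : P¹ F K ι
  infinite = [ 1# ∶ 0# ]⟨ (λ (1≈0 , _) → 1≉0 1≈0) ⟩

  affine-injective : ∀ {x y} → SameP F K ι (affine x) (affine y) → x ≈ y
  affine-injective e = trans (sym (*-identityʳ _)) (trans e (*-identityʳ _))

  infinite≉affine : ∀ {x} → ¬ SameP F K ι infinite (affine x)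
  infinite≉affine e = 1≉0 (trans (sym (*-identityʳ _)) (trans e (zeroʳ _)))

  affine≉infinite : ∀ {x} → ¬ SameP F K ι (affine x) infinite
  affine≉infinite e = 1≉0 (trans (sym (*-identityʳ _)) (trans (sym e) (zeroʳ _)))

  evalAt-W₀₁ : ∀ x → evalAt x W₀₁ ≈ Fibreₖ.wronskian x 1#
  evalAt-W₀₁ x = begin
    evalAt x W₀₁
      ≈⟨ evalAt-cong x ((G Fₚ.*ₚ D H) Fₚ.+ₚ ((F.- F.1#) Fₚ.·ₚ (D G Fₚ.*ₚ H))) W₀₁ W₀₁-expand ⟨
    evalAt x ((G Fₚ.*ₚ D H) Fₚ.+ₚ ((F.- F.1#) Fₚ.·ₚ (D G Fₚ.*ₚ H)))
      ≈⟨ evalAt-+ x (G Fₚ.*ₚ D H) ((F.- F.1#) Fₚ.·ₚ (D G Fₚ.*ₚ H)) ⟩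
    evalAt x (G Fₚ.*ₚ D H) + evalAt x ((F.- F.1#) Fₚ.·ₚ (D G Fₚ.*ₚ H))
      ≈⟨ +-cong (evalAt-* x G (D H)) (trans (evalAt-· x (F.- F.1#) (D G Fₚ.*ₚ H))
           (*-cong (trans (-‿homo F.1#) (-‿cong 1#-homo)) (evalAt-* x (D G) H))) ⟩
    evalAt x G * evalAt x (D H) + - 1# * (evalAt x (D G) * evalAt x H)
      ≈⟨ solve 3 (λ a b c → a :+ (:- con (+ 1)) :* (b :* c) := a :- b :* c)
           (evalAt x G * evalAt x (D H) ∷ evalAt x (D G) ∷ evalAt x H ∷ []) ⟩
    evalAt x G * evalAt x (D H) - evalAt x (D G) * evalAt x H
      ≈⟨ +-cong (*-congˡ (evalAt-deriv x H)) (-‿cong (*-congʳ (evalAt-deriv x G))) ⟨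
    Fibreₖ.wronskian x 1# ∎
    where D = PolyEvaluation.deriv F.commutativeRing

  affine-ramified : ∀ x → evalAt x W₀₁ ≈ 0# → IsRamificationPoint F K ι R (affine x)
  affine-ramified x root = e₃ , e₂ + 2 ×1 * x * e₃ , ≋⇒≈ₚ (≋-trans
    (solveₚ 9 (λ g₀ g₁ g₂ g₃ h₀ h₁ h₂ h₃ x →
        let module P = Fibre (expressions 9) g₀ g₁ g₂ g₃ h₀ h₁ h₂ h₃ x (con (+ 1))
            open Substitution (expressions 9) in
        multiply P.square P.affine-cofactor , P.affine-remainder)
      (ι g₀ ∷ ι g₁ ∷ ι g₂ ∷ ι g₃ ∷ ι h₀ ∷ ι h₁ ∷ ι h₂ ∷ ι h₃ ∷ x ∷ []))
    (drop (- x) ∷ trans (+-congˡ w≈0) (+-identityʳ e₁) ∷ refl ∷ refl ∷ []))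
    where
    open Fibreₖ x 1#
    w≈0 : wronskian ≈ 0#
    w≈0 = trans (sym (evalAt-W₀₁ x)) root

    drop : ∀ {a} c → a + c * wronskian ≈ a
    drop c = trans (+-congˡ (y≈0⇒x*y≈0 w≈0)) (+-identityʳ _)

  infinite-ramified : p₂₃ F.≈ F.0# → IsRamificationPoint F K ι R infinite
  infinite-ramified p₂₃≈0 = e₁ , e₀ , ≋⇒≈ₚ (≋-trans
    (solveₚ 8 (λ g₀ g₁ g₂ g₃ h₀ h₁ h₂ h₃ →
        let module P = Fibre (expressions 8) g₀ g₁ g₂ g₃ h₀ h₁ h₂ h₃ (con (+ 1)) (con (+ 0))
            open Substitution (expressions 8) in
        multiply P.square P.infinite-cofactor , P.infinite-remainder ++ [ P.e₃ ])
      (ι g₀ ∷ ι g₁ ∷ ι g₂ ∷ ι g₃ ∷ ι h₀ ∷ ι h₁ ∷ ι h₂ ∷ ι h₃ ∷ []))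
    (refl ∷ refl ∷ trans (+-congˡ (trans (-‿cong minor≈0) -0#≈0#)) (+-identityʳ e₂) ∷ refl ∷ []))
    where
    open Fibreₖ 1# 0#
    minor≈0 : ι g₂ * ι h₃ - ι g₃ * ι h₂ ≈ 0#
    minor≈0 = begin
      ι g₂ * ι h₃ - ι g₃ * ι h₂             ≈⟨ +-cong (*-homo g₂ h₃) (trans (-‿homo _) (-‿cong (*-homo g₃ h₂))) ⟨
      ι (g₂ F.* h₃) + ι (F.- (g₃ F.* h₂))   ≈⟨ +-homo _ _ ⟨
      ι p₂₃                                 ≈⟨ trans (⟦⟧-cong p₂₃≈0) 0#-homo ⟩
      0#                                    ∎

  four-affine : DistinctRoots (List.map ι W₀₁) 4 → ¬ AtMostThreeRamificationPoints F K ι R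
  four-affine (xs , roots , distinct) atMost3 = atMost3
    ((λ i → affine (xs i)) , (λ i → affine-ramified (xs i) (roots i)) ,
     (λ i j i≢j same → i≢j (distinct i j (affine-injective same))))

  infinite-and-three-affine : p₂₃ F.≈ F.0# → (xs : Fin 3 → Carrier) → (∀ i → evalAt (xs i) W₀₁ ≈ 0#) →
    (∀ i j → xs i ≈ xs j → i ≡ j) → ¬ AtMostThreeRamificationPoints F K ι R
  infinite-and-three-affine p₂₃≈0 xs roots distinct atMost3 = atMost3 (points , ramified , different)
    where
    points : Fin 4 → P¹ F K ι
    points zero    = infinite
    points (suc i) = affine (xs i)

    ramified : ∀ i → IsRamificationPoint F K ι R (points i)
    ramified zero    = infinite-ramified p₂₃≈0
    ramified (suc i) = affine-ramified (xs i) (roots i)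

    different : ∀ i j → i ≢ j → ¬ SameP F K ι (points i) (points j)
    different zero    zero    0≢0 _    = 0≢0 ≡.refl
    different zero    (suc j) _   same = infinite≉affine same
    different (suc i) zero    _   same = affine≉infinite same
    different (suc i) (suc j) i≢j same = i≢j (≡.cong suc (distinct i j (affine-injective same)))

-- The case distinction by the multiplicity of infinity

theorem5p3 : ∀ {c ℓ} (F : Field c ℓ) → IsFinite F → CharAtLeast5 F →
    (σ : Field.Carrier F) → IsNonSquare F σ →
    (R : RatExpr F) → IsCubic F R →
    ∀ {c' ℓ'} (K : Field c' ℓ') → IsAlgClosed K →
    (ι : Field.Carrier F → Field.Carrier K) → IsFieldHom F K ι →
    AtMostThreeRamificationPoints F K ι R →
    EquivalentOver F R (nf₁ F)
    ⊎ EquivalentOver F R (nf₂ F σ)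
    ⊎ EquivalentOver F R (nf₃ F)
    ⊎ EquivalentOver F R (nf₄ F σ)
theorem5p3 F finite char≥5 σ nonsquare
  R@((g₀ ∷ g₁ ∷ g₂ ∷ g₃ ∷ []) / (h₀ ∷ h₁ ∷ h₂ ∷ h₃ ∷ [])) cubic K closed ι ι-hom atMost3 =
  atInfinity (p₂₃ ≟ 0#) (p₁₃ ≟ 0#)
  where
  open Field F
  open PolyOps commutativeRing
  open PolyEvaluation commutativeRing using (deriv)
  open FieldProperties F
  open Pencil commutativeRing g₀ g₁ g₂ g₃ h₀ h₁ h₂ h₃
  open NormalForms F finite char≥5 σ nonsquare using (OneOfNormalForms; 2≉0)
  open Cubic F finite char≥5 σ nonsquare g₀ g₁ g₂ g₃ h₀ h₁ h₂ h₃ cubic K closed ι ι-hom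
  open RamificationPoints F K ι ι-hom g₀ g₁ g₂ g₃ h₀ h₁ h₂ h₃
  open Extension F K ι ι-hom
  module K = Field K
  module Kₚ = FieldProperties K

  quartic : (∃[ x ] PolyEvaluation.DoubleRoot K.commutativeRing (List.map ι W₀₁) x) ⊎
    Kₚ.DistinctRoots (List.map ι W₀₁) 4 → OneOfNormalForms R
  quartic (inj₁ (x , root , root′)) = doubleRoot root (K.trans (K.sym (evalAt-deriv x W₀₁)) root′)
  quartic (inj₂ distinct)           = ⊥-elim (four-affine distinct atMost3)

  module _ (p₂₃≈0 : p₂₃ ≈ 0#) where
    -- W₀₁ without its zero top coefficient: counting roots requires a nonzero leading coefficient,
    -- here 2 p₁₃.
    C : Poly
    C = p₀₁ ∷ 2 ×1 * p₀₂ ∷ 3 ×1 * p₀₃ + p₁₂ ∷ 2 ×1 * p₁₃ ∷ []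

    C≈W₀₁ : C ≈ₚ W₀₁
    C≈W₀₁ = refl , refl , refl , refl , sym p₂₃≈0 , _

    C′≈W₀₁′ : deriv C ≈ₚ deriv W₀₁
    C′≈W₀₁′ = refl , refl , refl ,
      sym (x+y≈0 p₂₃≈0 (x+y≈0 p₂₃≈0 (x+y≈0 p₂₃≈0 (x+y≈0 p₂₃≈0 refl)))) , refl , _

    cubicCase : (∃[ x ] PolyEvaluation.DoubleRoot K.commutativeRing (List.map ι C) x) ⊎
      Kₚ.DistinctRoots (List.map ι C) 3 → OneOfNormalForms R
    cubicCase (inj₁ (x , root , root′)) = doubleRoot (root-cong C W₀₁ C≈W₀₁ root)
      (root-cong (deriv C) (deriv W₀₁) C′≈W₀₁′ (K.trans (K.sym (evalAt-deriv x C)) root′))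
    cubicCase (inj₂ (xs , roots , distinct)) = ⊥-elim (infinite-and-three-affine p₂₃≈0 xs
      (λ i → root-cong C W₀₁ C≈W₀₁ (roots i)) distinct atMost3)

  -- Infinity is a root of W of multiplicity at least two, exactly one, or zero. In the middle case
  -- it is itself a ramification point, so three distinct affine roots already contradict the
  -- hypothesis.
  atInfinity : Dec (p₂₃ ≈ 0#) → Dec (p₁₃ ≈ 0#) → OneOfNormalForms R
  atInfinity (yes p₂₃≈0) (yes p₁₃≈0) = triplePoint-∞ p₂₃≈0 p₁₃≈0
  atInfinity (yes p₂₃≈0) (no  p₁₃≉0) = cubicCase p₂₃≈0 (Kₚ.doubleRoot-or-distinctRoots closed
    (ι p₀₁ ∷ ι (2 ×1 * p₀₂) ∷ ι (3 ×1 * p₀₃ + p₁₂) ∷ []) (ι (2 ×1 * p₁₃))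
    (λ e → x*y≉0 2≉0 p₁₃≉0 (ι-injective e)))
  atInfinity (no  p₂₃≉0) _           = quartic (Kₚ.doubleRoot-or-distinctRoots closed
    (ι p₀₁ ∷ ι (2 ×1 * p₀₂) ∷ ι (3 ×1 * p₀₃ + p₁₂) ∷ ι (2 ×1 * p₁₃) ∷ []) (ι p₂₃)
    (λ e → p₂₃≉0 (ι-injective e)))
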